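{- For an essentially profinite class $\mathcal{F}$ of simple graphs, the following are equivalent: (1) $\mathcal{F}$ is homomorphism distinguishing closed; (2) for every graph $K$, if $\vec{K}\in\mathrm{span}\{\vec{F}\in\mathbb{R}^{\Gamma(\mathcal{F}_K\cup\{K\})}\mid F\in\mathcal{F}_K\}$ then $K\in\mathcal{F}$; (3) $\mathcal{F}_K$ is homomorphism distinguishing closed for every graph $K$.
   Context: All graphs are finite, undirected, without multiple edges; simple means without loops. $\hom(F,G)$ counts homomorphisms; $G\equiv_{\mathcal{F}}H$ means $\hom(F,G)=\hom(F,H)$ for all $F\in\mathcal{F}$; $\mathrm{cl}(\mathcal{F})$ is the class of simple graphs $K$ such that for all simple $G,H$, $G\equiv_{\mathcal{F}}H$ implies $\hom(K,G)=\hom(K,H)$; $\mathcal{F}$ is homomorphism distinguishing closed if $\mathrm{cl}(\mathcal{F})=\mathcal{F}$. $\Gamma(F)$ is the set of isomorphism types of connected components of $F$, $\Gamma(\mathcal{F})=\bigcup_{F\in\mathcal{F}}\Gamma(F)$. $\mathcal{F}_K=\{F\in\mathcal{F}\mid\hom(F,K)>0\}$. $\mathcal{F}$ is essentially finite if $\Gamma(\mathcal{F})$ is finite, essentially profinite if $\mathcal{F}_K$ is essentially finite for all graphs $K$. For a finite set $\mathcal{C}$ of connected graphs and a graph $F$ with $\Gamma(F)\subseteq\mathcal{C}$, $\vec F\in\mathbb{R}^{\mathcal{C}}$ is the vector whose $C$-entry is the number of connected components of $F$ isomorphic to $C$. -}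

module Defs where

open import Level using (Level; 0ℓ; _⊔_)
open import Algebra.Bundles using (CommutativeRing)
open import Data.Bool using (Bool; false; T; T?)
open import Data.Bool.Properties using () renaming (_≟_ to _≟ᵇ_)
open import Data.Fin using (Fin; finToFun; funToFin) renaming (_≤_ to _≤ᶠ_)
open import Data.Fin.Permutation using (Permutation; permutation; _⟨$⟩ʳ_; _⟨$⟩ˡ_; inverseˡ; inverseʳ)
open import Data.Fin.Properties using (all?; any?; finToFun-funToFin) renaming (_≟_ to _≟ᶠ_; _≤?_ to _≤ᶠ?_)
open import Data.List using (List; []; _∷_; length; lookup; filter; allFin)
open import Data.List.Membership.Propositional using () renaming (_∈_ to _∈ˡ_)
open import Data.List.Membership.Propositional.Properties using (∈-allFin)
open import Data.List.Relation.Unary.Any using (Any; here; there)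
open import Data.Nat using (ℕ; _^_; _<_; _≥_) renaming (_⊔_ to _⊔ⁿ_)
open import Data.Nat.Properties using (m≤m⊔n; m≤n⊔m) renaming (≤-trans to ≤ⁿ-trans; ≤-refl to ≤ⁿ-refl)
open import Data.Integer using (+_)
open import Data.Product using (Σ; ∃; _×_; _,_; proj₁; proj₂)
open import Data.Rational as ℚ using (ℚ; 0ℚ; 1ℚ; ½; ∣_∣)
import Data.Rational.Properties as ℚₚ
open import Data.Rational.Solver using (module +-*-Solver)
open import Data.Sum using (_⊎_; inj₁; inj₂)
open import Data.Vec.Functional using (Vector)
open import Function using (_∘_; _$_)
open import Relation.Binary.Construct.Closure.ReflexiveTransitive using (Star; _◅_; _◅◅_) renaming (ε to nil)
open import Relation.Binary.Definitions using () renaming (Decidable to Decidable₂)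
open import Relation.Binary.PropositionalEquality
  using (_≡_; refl; sym; trans; cong; cong₂; subst; subst₂)
open import Relation.Nullary using (Dec; yes; no)
open import Relation.Nullary.Decidable using (map′; _×-dec_; _⊎-dec_; _→-dec_)
open import Relation.Unary using (Pred; Decidable; _∈_; _≐_)

private variable
  ℓ ℓ′ : Level

-- Real numbers: Cauchy sequences of rationals, identified when their
-- difference tends to zero

Cauchy : (ℕ → ℚ) → Set
Cauchy x = ∀ {ε} → 0ℚ ℚ.< ε → ∃ λ N → ∀ {m n} → m ≥ N → n ≥ N → ∣ x m ℚ.- x n ∣ ℚ.< ε

record ℝ : Set where
  constructor mkℝ
  field
    seq    : ℕ → ℚ
    cauchy : Cauchy seq

open ℝ public

infix 4 _≈_
_≈_ : ℝ → ℝ → Set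
x ≈ y = ∀ {ε} → 0ℚ ℚ.< ε → ∃ λ N → ∀ {n} → n ≥ N → ∣ seq x n ℚ.- seq y n ∣ ℚ.< ε

private
  halve : ∀ {ε} → 0ℚ ℚ.< ε → ∃ λ δ → 0ℚ ℚ.< δ × δ ℚ.+ δ ≡ ε
  halve {ε} 0<ε = ½ ℚ.* ε
    , subst (ℚ._< ½ ℚ.* ε) (ℚₚ.*-zeroʳ ½) (ℚₚ.*-monoʳ-<-pos ½ 0<ε)
    , trans (sym (ℚₚ.*-distribʳ-+ ε ½ ½)) (ℚₚ.*-identityˡ ε)

  scale : ∀ {B ε} → 0ℚ ℚ.< B → 0ℚ ℚ.< ε → ∃ λ δ → 0ℚ ℚ.< δ × B ℚ.* δ ≡ ε
  scale {B} {ε} 0<B 0<ε = B⁻¹ ℚ.* ε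
    , subst (ℚ._< B⁻¹ ℚ.* ε) (ℚₚ.*-zeroʳ B⁻¹) (ℚₚ.*-monoʳ-<-pos B⁻¹ 0<ε)
    , trans (sym (ℚₚ.*-assoc B B⁻¹ ε))
        (trans (cong (ℚ._* ε) (ℚₚ.*-inverseʳ B)) (ℚₚ.*-identityˡ ε))
    where
    instance
      B-pos = ℚ.positive 0<B
      B-nonZero = ℚₚ.pos⇒nonZero B
    B⁻¹ = ℚ.1/ B
    instance
      B⁻¹-pos = ℚₚ.1/pos⇒pos B

  ∣+∣< : ∀ p q {r δ δ′} → r ≡ p ℚ.+ q → ∣ p ∣ ℚ.< δ → ∣ q ∣ ℚ.< δ′ → ∣ r ∣ ℚ.< δ ℚ.+ δ′
  ∣+∣< p q refl p< q< = ℚₚ.≤-<-trans (ℚₚ.∣p+q∣≤∣p∣+∣q∣ p q) (ℚₚ.+-mono-< p< q<)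

  ∣*∣< : ∀ p q {B δ} → 0ℚ ℚ.< δ → ∣ p ∣ ℚ.< B → ∣ q ∣ ℚ.< δ → ∣ p ℚ.* q ∣ ℚ.< B ℚ.* δ
  ∣*∣< p q {B} {δ} 0<δ p< q< rewrite ℚₚ.∣p*q∣≡∣p∣*∣q∣ p q = ℚₚ.≤-<-trans
    (ℚₚ.*-monoˡ-≤-nonNeg ∣ p ∣ {{ℚₚ.∣-∣-nonNeg p}} (ℚₚ.<⇒≤ q<))
    (ℚₚ.*-monoˡ-<-pos δ {{ℚ.positive 0<δ}} p<)

  ∣-∣-comm : ∀ p q → ∣ p ℚ.- q ∣ ≡ ∣ q ℚ.- p ∣
  ∣-∣-comm p q = trans (sym (ℚₚ.∣-p∣≡∣p∣ (p ℚ.- q))) (cong ∣_∣ (lemma p q))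
    where
    open +-*-Solver
    lemma : ∀ p q → ℚ.- (p ℚ.- q) ≡ q ℚ.- p
    lemma = solve 2 (λ p q → :- (p :- q) := q :- p) refl

  telescope : ∀ p q r → p ℚ.- r ≡ (p ℚ.- q) ℚ.+ (q ℚ.- r)
  telescope = solve 3 (λ p q r → p :- r := (p :- q) :+ (q :- r)) refl
    where open +-*-Solver

  +-diff : ∀ p q r s → (p ℚ.+ q) ℚ.- (r ℚ.+ s) ≡ (p ℚ.- r) ℚ.+ (q ℚ.- s)
  +-diff = solve 4 (λ p q r s → (p :+ q) :- (r :+ s) := (p :- r) :+ (q :- s)) refl
    where open +-*-Solver

  *-diff : ∀ p q r s → (p ℚ.* q) ℚ.- (r ℚ.* s) ≡ p ℚ.* (q ℚ.- s) ℚ.+ s ℚ.* (p ℚ.- r)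
  *-diff = solve 4 (λ p q r s → (p :* q) :- (r :* s) := p :* (q :- s) :+ s :* (p :- r)) refl
    where open +-*-Solver

  neg-diff : ∀ p q → (ℚ.- p) ℚ.- (ℚ.- q) ≡ q ℚ.- p
  neg-diff = solve 2 (λ p q → (:- p) :- (:- q) := q :- p) refl
    where open +-*-Solver

  ⊔-≥ˡ : ∀ M N {n} → n ≥ M ⊔ⁿ N → n ≥ M
  ⊔-≥ˡ M N = ≤ⁿ-trans (m≤m⊔n M N)

  ⊔-≥ʳ : ∀ M N {n} → n ≥ M ⊔ⁿ N → n ≥ N
  ⊔-≥ʳ M N = ≤ⁿ-trans (m≤n⊔m M N)

  eventually-bounded : ∀ x → ∃ λ B → 0ℚ ℚ.< B × ∃ λ N → ∀ {n} → n ≥ N → ∣ seq x n ∣ ℚ.< B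
  eventually-bounded x with cauchy x (ℚₚ.positive⁻¹ 1ℚ)
  ... | N , close = 1ℚ ℚ.+ ∣ xN ∣
    , ℚₚ.<-≤-trans (ℚₚ.positive⁻¹ 1ℚ)
        (subst (ℚ._≤ 1ℚ ℚ.+ ∣ xN ∣) (ℚₚ.+-identityʳ 1ℚ) (ℚₚ.+-monoʳ-≤ 1ℚ (ℚₚ.0≤∣p∣ xN)))
    , N , λ {n} n≥N → ℚₚ.≤-<-trans
        (subst (λ z → ∣ z ∣ ℚ.≤ ∣ seq x n ℚ.- xN ∣ ℚ.+ ∣ xN ∣) (lemma (seq x n) xN)
          (ℚₚ.∣p+q∣≤∣p∣+∣q∣ (seq x n ℚ.- xN) xN))
        (ℚₚ.+-monoˡ-< ∣ xN ∣ (close n≥N ≤ⁿ-refl))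
    where
    open +-*-Solver
    xN = seq x N
    lemma : ∀ p q → (p ℚ.- q) ℚ.+ q ≡ p
    lemma = solve 2 (λ p q → (p :- q) :+ q := p) refl

  ≗⇒≈ : ∀ {x y} → (∀ n → seq x n ≡ seq y n) → x ≈ y
  ≗⇒≈ {x} {y} x≗y 0<ε = 0 , λ {n} _ → subst (ℚ._< _)
    (sym (trans (cong (λ z → ∣ z ℚ.- seq y n ∣) (x≗y n)) (cong ∣_∣ (ℚₚ.+-inverseʳ (seq y n))))) 0<ε

fromℚ : ℚ → ℝ
fromℚ q = mkℝ (λ _ → q) λ 0<ε → 0 , λ _ _ →
  subst (ℚ._< _) (sym (cong ∣_∣ (ℚₚ.+-inverseʳ q))) 0<ε

fromℕ : ℕ → ℝ
fromℕ n = fromℚ (+ n ℚ./ 1)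

_+ᴿ_ : ℝ → ℝ → ℝ
x +ᴿ y = mkℝ (λ n → seq x n ℚ.+ seq y n) λ 0<ε →
  let δ , 0<δ , δ+δ≡ε = halve 0<ε
      M , x-close = cauchy x 0<δ
      N , y-close = cauchy y 0<δ
  in M ⊔ⁿ N , λ {m} {n} m≥ n≥ → subst (_ ℚ.<_) δ+δ≡ε $
    ∣+∣< (seq x m ℚ.- seq x n) (seq y m ℚ.- seq y n)
      (+-diff (seq x m) (seq y m) (seq x n) (seq y n))
      (x-close (⊔-≥ˡ M N m≥) (⊔-≥ˡ M N n≥)) (y-close (⊔-≥ʳ M N m≥) (⊔-≥ʳ M N n≥))

-ᴿ_ : ℝ → ℝ
-ᴿ x = mkℝ (λ n → ℚ.- seq x n) λ 0<ε →
  let N , close = cauchy x 0<ε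
  in N , λ {m} {n} m≥ n≥ →
    subst (ℚ._< _) (cong ∣_∣ (sym (neg-diff (seq x m) (seq x n)))) (close n≥ m≥)

_*ᴿ_ : ℝ → ℝ → ℝ
x *ᴿ y = mkℝ (λ n → seq x n ℚ.* seq y n) λ 0<ε →
  let η , 0<η , η+η≡ε = halve 0<ε
      A , 0<A , K , x-bound = eventually-bounded x
      B , 0<B , L , y-bound = eventually-bounded y
      δ , 0<δ , Aδ≡η = scale 0<A 0<η
      γ , 0<γ , Bγ≡η = scale 0<B 0<η
      M , y-close = cauchy y 0<δ
      N , x-close = cauchy x 0<γ
  in (K ⊔ⁿ L) ⊔ⁿ (M ⊔ⁿ N) , λ {m} {n} m≥ n≥ →
    let m≥₁ = ⊔-≥ˡ (K ⊔ⁿ L) (M ⊔ⁿ N) m≥ ; m≥₂ = ⊔-≥ʳ (K ⊔ⁿ L) (M ⊔ⁿ N) m≥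
        n≥₁ = ⊔-≥ˡ (K ⊔ⁿ L) (M ⊔ⁿ N) n≥ ; n≥₂ = ⊔-≥ʳ (K ⊔ⁿ L) (M ⊔ⁿ N) n≥
    in subst (_ ℚ.<_) (trans (cong₂ ℚ._+_ Aδ≡η Bγ≡η) η+η≡ε) $
      ∣+∣< (seq x m ℚ.* (seq y m ℚ.- seq y n)) (seq y n ℚ.* (seq x m ℚ.- seq x n))
        (*-diff (seq x m) (seq y m) (seq x n) (seq y n))
        (∣*∣< (seq x m) (seq y m ℚ.- seq y n) 0<δ (x-bound (⊔-≥ˡ K L m≥₁))
          (y-close (⊔-≥ˡ M N m≥₂) (⊔-≥ˡ M N n≥₂)))
        (∣*∣< (seq y n) (seq x m ℚ.- seq x n) 0<γ (y-bound (⊔-≥ʳ K L n≥₁))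
          (x-close (⊔-≥ʳ M N m≥₂) (⊔-≥ʳ M N n≥₂)))

private
  ≈-trans : ∀ {x y z} → x ≈ y → y ≈ z → x ≈ z
  ≈-trans {x} {y} {z} x≈y y≈z 0<ε =
    let δ , 0<δ , δ+δ≡ε = halve 0<ε
        M , xy = x≈y 0<δ
        N , yz = y≈z 0<δ
    in M ⊔ⁿ N , λ {n} n≥ → subst (_ ℚ.<_) δ+δ≡ε $
      ∣+∣< (seq x n ℚ.- seq y n) (seq y n ℚ.- seq z n)
        (telescope (seq x n) (seq y n) (seq z n)) (xy (⊔-≥ˡ M N n≥)) (yz (⊔-≥ʳ M N n≥))

  ≈-sym : ∀ {x y} → x ≈ y → y ≈ x
  ≈-sym {x} {y} x≈y 0<ε =
    let N , xy = x≈y 0<ε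
    in N , λ {n} n≥ → subst (ℚ._< _) (∣-∣-comm (seq x n) (seq y n)) (xy n≥)

  +ᴿ-cong : ∀ {x x′ y y′} → x ≈ x′ → y ≈ y′ → (x +ᴿ y) ≈ (x′ +ᴿ y′)
  +ᴿ-cong {x} {x′} {y} {y′} x≈x′ y≈y′ 0<ε =
    let δ , 0<δ , δ+δ≡ε = halve 0<ε
        M , xx = x≈x′ 0<δ
        N , yy = y≈y′ 0<δ
    in M ⊔ⁿ N , λ {n} n≥ → subst (_ ℚ.<_) δ+δ≡ε $
      ∣+∣< (seq x n ℚ.- seq x′ n) (seq y n ℚ.- seq y′ n)
        (+-diff (seq x n) (seq y n) (seq x′ n) (seq y′ n)) (xx (⊔-≥ˡ M N n≥)) (yy (⊔-≥ʳ M N n≥))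

  -ᴿ-cong : ∀ {x y} → x ≈ y → (-ᴿ x) ≈ (-ᴿ y)
  -ᴿ-cong {x} {y} x≈y 0<ε =
    let N , xy = x≈y 0<ε
    in N , λ {n} n≥ → subst (ℚ._< _)
      (trans (∣-∣-comm (seq x n) (seq y n)) (cong ∣_∣ (sym (neg-diff (seq x n) (seq y n))))) (xy n≥)

  *ᴿ-cong : ∀ {x x′ y y′} → x ≈ x′ → y ≈ y′ → (x *ᴿ y) ≈ (x′ *ᴿ y′)
  *ᴿ-cong {x} {x′} {y} {y′} x≈x′ y≈y′ 0<ε =
    let η , 0<η , η+η≡ε = halve 0<ε
        A , 0<A , K , x-bound = eventually-bounded x
        B , 0<B , L , y-bound = eventually-bounded y′
        δ , 0<δ , Aδ≡η = scale 0<A 0<η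
        γ , 0<γ , Bγ≡η = scale 0<B 0<η
        M , yy = y≈y′ 0<δ
        N , xx = x≈x′ 0<γ
    in (K ⊔ⁿ L) ⊔ⁿ (M ⊔ⁿ N) , λ {n} n≥ →
      let n≥₁ = ⊔-≥ˡ (K ⊔ⁿ L) (M ⊔ⁿ N) n≥ ; n≥₂ = ⊔-≥ʳ (K ⊔ⁿ L) (M ⊔ⁿ N) n≥
      in subst (_ ℚ.<_) (trans (cong₂ ℚ._+_ Aδ≡η Bγ≡η) η+η≡ε) $
        ∣+∣< (seq x n ℚ.* (seq y n ℚ.- seq y′ n)) (seq y′ n ℚ.* (seq x n ℚ.- seq x′ n))
          (*-diff (seq x n) (seq y n) (seq x′ n) (seq y′ n))
          (∣*∣< (seq x n) (seq y n ℚ.- seq y′ n) 0<δ (x-bound (⊔-≥ˡ K L n≥₁)) (yy (⊔-≥ˡ M N n≥₂)))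
          (∣*∣< (seq y′ n) (seq x n ℚ.- seq x′ n) 0<γ (y-bound (⊔-≥ʳ K L n≥₁)) (xx (⊔-≥ʳ M N n≥₂)))

ℝ-commutativeRing : CommutativeRing 0ℓ 0ℓ
ℝ-commutativeRing = record
  { Carrier = ℝ
  ; _≈_ = _≈_
  ; _+_ = _+ᴿ_
  ; _*_ = _*ᴿ_
  ; -_ = -ᴿ_
  ; 0# = fromℚ 0ℚ
  ; 1# = fromℚ 1ℚ
  ; isCommutativeRing = record
    { isRing = record
      { +-isAbelianGroup = record
        { isGroup = record
          { isMonoid = record
            { isSemigroup = record
              { isMagma = record
                { isEquivalence = record
                  { refl  = λ {x} → ≗⇒≈ {x} {x} λ _ → refl
                  ; sym   = λ {x} {y} → ≈-sym {x} {y}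
                  ; trans = λ {x} {y} {z} → ≈-trans {x} {y} {z}
                  }
                ; ∙-cong = λ {x} {x′} {y} {y′} → +ᴿ-cong {x} {x′} {y} {y′}
                }
              ; assoc = λ x y z → ≗⇒≈ {(x +ᴿ y) +ᴿ z} {x +ᴿ (y +ᴿ z)}
                  λ n → ℚₚ.+-assoc (seq x n) (seq y n) (seq z n)
              }
            ; identity = (λ x → ≗⇒≈ {fromℚ 0ℚ +ᴿ x} {x} λ n → ℚₚ.+-identityˡ (seq x n))
                       , (λ x → ≗⇒≈ {x +ᴿ fromℚ 0ℚ} {x} λ n → ℚₚ.+-identityʳ (seq x n))
            }
          ; inverse = (λ x → ≗⇒≈ {(-ᴿ x) +ᴿ x} {fromℚ 0ℚ} λ n → ℚₚ.+-inverseˡ (seq x n))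
                    , (λ x → ≗⇒≈ {x +ᴿ (-ᴿ x)} {fromℚ 0ℚ} λ n → ℚₚ.+-inverseʳ (seq x n))
          ; ⁻¹-cong = λ {x} {y} → -ᴿ-cong {x} {y}
          }
        ; comm = λ x y → ≗⇒≈ {x +ᴿ y} {y +ᴿ x} λ n → ℚₚ.+-comm (seq x n) (seq y n)
        }
      ; *-cong = λ {x} {x′} {y} {y′} → *ᴿ-cong {x} {x′} {y} {y′}
      ; *-assoc = λ x y z → ≗⇒≈ {(x *ᴿ y) *ᴿ z} {x *ᴿ (y *ᴿ z)}
          λ n → ℚₚ.*-assoc (seq x n) (seq y n) (seq z n)
      ; *-identity = (λ x → ≗⇒≈ {fromℚ 1ℚ *ᴿ x} {x} λ n → ℚₚ.*-identityˡ (seq x n))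
                   , (λ x → ≗⇒≈ {x *ᴿ fromℚ 1ℚ} {x} λ n → ℚₚ.*-identityʳ (seq x n))
      ; distrib = (λ x y z → ≗⇒≈ {x *ᴿ (y +ᴿ z)} {(x *ᴿ y) +ᴿ (x *ᴿ z)}
                    λ n → ℚₚ.*-distribˡ-+ (seq x n) (seq y n) (seq z n))
                , (λ x y z → ≗⇒≈ {(y +ᴿ z) *ᴿ x} {(y *ᴿ x) +ᴿ (z *ᴿ x)}
                    λ n → ℚₚ.*-distribʳ-+ (seq x n) (seq y n) (seq z n))
      }
    ; *-comm = λ x y → ≗⇒≈ {x *ᴿ y} {y *ᴿ x} λ n → ℚₚ.*-comm (seq x n) (seq y n)
    }
  }

open import Algebra.Properties.Monoid.Sum (CommutativeRing.+-monoid ℝ-commutativeRing)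
  using (sum-syntax)

-- Finite linear combinations of a family b of vectors in ℝ^I.
span : ∀ {i j} {I : Set i} {J : Set j} → (J → I → ℝ) → Pred (I → ℝ) (i ⊔ j)
span {I = I} {J} b x =
  ∃ λ n → Σ (Vector ℝ n) λ a → Σ (Vector J n) λ j →
    ∀ i → x i ≈ ∑[ k < n ] (a k *ᴿ b (j k) i)

record Graph : Set where
  field
    order   : ℕ
    adj     : Fin order → Fin order → Bool
    adj-sym : ∀ u v → adj u v ≡ adj v u

  Vertex : Set
  Vertex = Fin order

  _~_ : Vertex → Vertex → Set
  u ~ v = T (adj u v)

open Graph public using (order; adj; adj-sym; Vertex)

Simple : Pred Graph 0ℓ
Simple G = ∀ v → adj G v v ≡ false

count : ∀ {n} {P : Pred (Fin n) ℓ} → Decidable P → ℕ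
count {n = n} P? = length (filter P? (allFin n))

IsHom : (F G : Graph) → (Vertex F → Vertex G) → Set
IsHom F G f = ∀ u v → u F.~ v → f u G.~ f v
  where module F = Graph F ; module G = Graph G

isHom? : ∀ F G → Decidable (IsHom F G)
isHom? F G f = all? λ u → all? λ v → T? (adj F u v) →-dec T? (adj G (f u) (f v))

-- finToFun enumerates all functions Vertex F → Vertex G.
hom : Graph → Graph → ℕ
hom F G = count {n = order G ^ order F} (isHom? F G ∘ finToFun)

IsIso : (G H : Graph) → Permutation (order G) (order H) → Set
IsIso G H π = ∀ u v → adj G u v ≡ adj H (π ⟨$⟩ʳ u) (π ⟨$⟩ʳ v)

infix 4 _≅_ _≅?_
_≅_ : Graph → Graph → Set
G ≅ H = Σ (Permutation (order G) (order H)) (IsIso G H)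

_≅?_ : Decidable₂ _≅_
G ≅? H = map′ to from
  (any? λ i → any? λ j → inverses? (finToFun i) (finToFun j) ×-dec preserves? (finToFun i))
  where
  Inverses : (Vertex G → Vertex H) → (Vertex H → Vertex G) → Set
  Inverses f g = (∀ v → f (g v) ≡ v) × (∀ u → g (f u) ≡ u)

  inverses? : ∀ f g → Dec (Inverses f g)
  inverses? f g = all? (λ v → f (g v) ≟ᶠ v) ×-dec all? (λ u → g (f u) ≟ᶠ u)

  Preserves : Pred (Vertex G → Vertex H) 0ℓ
  Preserves f = ∀ u v → adj G u v ≡ adj H (f u) (f v)

  preserves? : Decidable Preserves
  preserves? f = all? λ u → all? λ v → adj G u v ≟ᵇ adj H (f u) (f v)

  to : (∃ λ i → ∃ λ j → Inverses (finToFun i) (finToFun j) × Preserves (finToFun i)) → G ≅ H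
  to (i , j , (fg , gf) , pres) = permutation (finToFun i) (finToFun j) fg gf , pres

  from : G ≅ H → ∃ λ i → ∃ λ j → Inverses (finToFun i) (finToFun j) × Preserves (finToFun i)
  from (π , pres) = funToFin f , funToFin g
    , ( (λ v → trans (f≗ _) (trans (cong f (g≗ v)) (inverseʳ π)))
      , (λ u → trans (g≗ _) (trans (cong g (f≗ u)) (inverseˡ π))) )
    , λ u v → trans (pres u v) (cong₂ (adj H) (sym (f≗ u)) (sym (f≗ v)))
    where
    f = π ⟨$⟩ʳ_
    g = π ⟨$⟩ˡ_
    f≗ = finToFun-funToFin f
    g≗ = finToFun-funToFin g

module _ (G : Graph) where
  open Graph G using (_~_)

  Reachable : Vertex G → Vertex G → Set
  Reachable = Star _~_

  private
    -- Walks whose interior vertices all lie in a given list.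
    Via : List (Vertex G) → Vertex G → Vertex G → Set
    Via []       u v = u ≡ v ⊎ u ~ v
    Via (w ∷ ws) u v = Via ws u v ⊎ (Via ws u w × Via ws w v)

    via? : ∀ ws → Decidable₂ (Via ws)
    via? []       u v = (u ≟ᶠ v) ⊎-dec T? (adj G u v)
    via? (w ∷ ws) u v = via? ws u v ⊎-dec (via? ws u w ×-dec via? ws w v)

    via-sound : ∀ ws {u v} → Via ws u v → Reachable u v
    via-sound []       (inj₁ refl)    = nil
    via-sound []       (inj₂ u~v)     = u~v ◅ nil
    via-sound (w ∷ ws) (inj₁ p)       = via-sound ws p
    via-sound (w ∷ ws) (inj₂ (p , q)) = via-sound ws p ◅◅ via-sound ws q

    via-base : ∀ ws {u v} → u ≡ v ⊎ u ~ v → Via ws u v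
    via-base []       p = p
    via-base (w ∷ ws) p = inj₁ (via-base ws p)

    via-to-head : ∀ {w} ws {u} → Via (w ∷ ws) u w → Via ws u w
    via-to-head ws (inj₁ p)       = p
    via-to-head ws (inj₂ (p , _)) = p

    via-from-head : ∀ {w} ws {v} → Via (w ∷ ws) w v → Via ws w v
    via-from-head ws (inj₁ p)       = p
    via-from-head ws (inj₂ (_ , p)) = p

    via-trans : ∀ ws {u x v} → x ∈ˡ ws → Via ws u x → Via ws x v → Via ws u v
    via-trans (w ∷ ws) (here refl) p q = inj₂ (via-to-head ws p , via-from-head ws q)
    via-trans (w ∷ ws) (there x∈) (inj₁ p) (inj₁ q) = inj₁ (via-trans ws x∈ p q)
    via-trans (w ∷ ws) (there x∈) (inj₁ p) (inj₂ (q , r)) = inj₂ (via-trans ws x∈ p q , r)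
    via-trans (w ∷ ws) (there x∈) (inj₂ (p , q)) (inj₁ r) = inj₂ (p , via-trans ws x∈ q r)
    via-trans (w ∷ ws) (there x∈) (inj₂ (p , _)) (inj₂ (_ , r)) = inj₂ (p , r)

    via-complete : ∀ {u v} → Reachable u v → Via (allFin (order G)) u v
    via-complete nil         = via-base _ (inj₁ refl)
    via-complete (u~w ◅ w⋯v) =
      via-trans _ (∈-allFin _) (via-base _ (inj₂ u~w)) (via-complete w⋯v)

  reachable? : Decidable₂ Reachable
  reachable? u v = map′ (via-sound _) via-complete (via? (allFin (order G)) u v)

  induced : List (Vertex G) → Graph
  induced vs = record
    { order   = length vs
    ; adj     = λ i j → adj G (lookup vs i) (lookup vs j)
    ; adj-sym = λ i j → adj-sym G (lookup vs i) (lookup vs j)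
    }

  component : Vertex G → Graph
  component v = induced (filter (reachable? v) (allFin (order G)))

  -- Every component has exactly one least vertex.
  Least : Pred (Vertex G) 0ℓ
  Least v = ∀ u → Reachable v u → v ≤ᶠ u

  least? : Decidable Least
  least? v = all? λ u → reachable? v u →-dec (v ≤ᶠ? u)

  -- The number of connected components of G isomorphic to C.
  multiplicity : Graph → ℕ
  multiplicity C = count λ v → least? v ×-dec (C ≅? component v)

  -- Isomorphism types are represented by isomorphism-closed predicates.
  Γ : Pred Graph 0ℓ
  Γ C = ∃ λ v → C ≅ component v

⋃Γ : Pred Graph ℓ → Pred Graph ℓ
⋃Γ 𝓕 C = ∃ λ F → F ∈ 𝓕 × C ∈ Γ F

-- The vector of F in ℝ^𝓒.  It takes equal values at isomorphic members
-- of 𝓒, so it is a vector indexed by isomorphism types.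
vec : (𝓒 : Pred Graph ℓ) → Graph → ∃ 𝓒 → ℝ
vec 𝓒 F (C , _) = fromℕ (multiplicity F C)

_≡[_]_ : Graph → Pred Graph ℓ → Graph → Set ℓ
G ≡[ 𝓕 ] H = ∀ F → F ∈ 𝓕 → hom F G ≡ hom F H

cl : Pred Graph ℓ → Pred Graph ℓ
cl 𝓕 K = Simple K × (∀ G H → Simple G → Simple H → G ≡[ 𝓕 ] H → hom K G ≡ hom K H)

HomDistinguishingClosed : Pred Graph ℓ → Set ℓ
HomDistinguishingClosed 𝓕 = cl 𝓕 ≐ 𝓕

infixl 7 _↓_
_↓_ : Pred Graph ℓ → Graph → Pred Graph ℓ
(𝓕 ↓ K) F = F ∈ 𝓕 × 0 < hom F K

EssentiallyFinite : Pred Graph ℓ → Set ℓ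
EssentiallyFinite 𝓕 = ∃ λ (Cs : List Graph) → ∀ {C} → C ∈ ⋃Γ 𝓕 → Any (C ≅_) Cs

-- If K had a loop, then 𝓕 ↓ K would be all of 𝓕, so K has to range
-- over simple graphs for this not to reduce to EssentiallyFinite.
EssentiallyProfinite : Pred Graph ℓ → Set ℓ
EssentiallyProfinite 𝓕 = ∀ K → Simple K → EssentiallyFinite (𝓕 ↓ K)

module Submission where

-- For connected C, hom(C, −) is additive under disjoint unions and multiplicative under products,
-- and hom(F, G) is the product of hom(C, G) over the components C of F.  Hence, if a positive
-- multiple of vec K is an integer combination of vectors vec F with F → K, then comparing powers
-- shows that hom(K, −) is determined by the hom(F, −).  If there is no such relation, elimination
-- over ℤ gives an integer vector z orthogonal to all the vec F but not to vec K.  By Lovász's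
-- theorem and the two ring operations, there are graphs G and H with
-- hom(C, G) / hom(C, H) = ((t + 1) / t) ^ z(C) for all C in question, so hom(F, −) agrees on G and
-- H for F → K while hom(K, −) does not.  Replacing G and H by G × K and H × K makes them simple
-- and makes hom(F, −) vanish on both for all other F.

open import Algebra.Bundles using (CommutativeRing)
open import Axiom.ExcludedMiddle using (ExcludedMiddle)
open import Data.Bool using (Bool; true; false; T; _∧_; if_then_else_)
open import Data.Bool.Properties using (T-∧) renaming (_≟_ to _≟ᵇ_)
open import Data.Empty using (⊥-elim)
open import Data.Fin using (Fin; zero; suc; finToFun; funToFin; combine; remQuot; punchOut; splitAt; _↑ˡ_; _↑ʳ_)
  renaming (_<_ to _<ᶠ_)
open import Data.Fin.Induction using (<-wellFounded)
open import Data.Fin.Permutation using (permutation; flip; _∘ₚ_; _⟨$⟩ʳ_; _⟨$⟩ˡ_; inverseˡ; inverseʳ; ↔⇒≡)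
  renaming (id to idₚ)
open import Data.Fin.Properties
  using ( all?; any?; ¬∀⟶∃¬; ≤-antisym; suc-injective; punchOut-injective; injective⇒≤; +↔⊎
        ; finToFun-funToFin; funToFin-finToFin; combine-remQuot; remQuot-combine
        ; splitAt-↑ˡ; splitAt-↑ʳ; splitAt⁻¹-↑ˡ; splitAt⁻¹-↑ʳ; ↑ˡ-injective; ↑ʳ-injective )
  renaming (_≟_ to _≟ᶠ_; _<?_ to _<ᶠ?_)
open import Data.Integer as ℤ using (ℤ; +_; -[1+_]; 0ℤ; 1ℤ; ∣_∣)
import Data.Integer.Properties as ℤₚ
import Data.Integer.Tactic.RingSolver as ℤ-Solver
open import Data.List using (List; []; _∷_; _++_; length; lookup; filter; map; allFin)
open import Data.List.Membership.Propositional.Properties using (∈-allFin; ∈-filter⁺; ∈-filter⁻; ∈-lookup)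
open import Data.List.Properties using (filter-accept; filter-reject; filter-≐)
open import Data.List.Relation.Unary.All as All using (All; []; _∷_)
open import Data.List.Relation.Unary.All.Properties using (¬Any⇒All¬)
open import Data.List.Relation.Unary.AllPairs using (AllPairs; []; _∷_)
open import Data.List.Relation.Unary.Any as Any using (Any; here; there)
open import Data.List.Relation.Unary.Any.Properties using (lookup-index; ++⁺ˡ; ++⁺ʳ; map⁺)
open import Data.List.Relation.Unary.Unique.Propositional using (Unique)
open import Data.List.Relation.Unary.Unique.Propositional.Properties using (allFin⁺; filter⁺)
open import Data.Nat as ℕ using (ℕ; zero; suc; _+_; _*_; _^_; _∸_; _≤_; _<_; _⊔_; z≤n; s≤s; >-nonZero)
open import Data.Nat.Properties
  using ( *-1-commutativeMonoid; +-*-semiring; +-suc; +-cancelʳ-≡; m∸n+n≡m; m≤n⇒∃[o]m+o≡n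
        ; *-comm; *-identityˡ; *-identityʳ; *-zeroʳ; *-cancelˡ-≡; *-cancelʳ-≡; *-mono-≤; m*n≢0; m*n≡0⇒m≡0∨n≡0
        ; ^-zeroˡ; ^-distribˡ-+-*; ^-*-assoc; ^-monoˡ-<; m^n>0; m^n≢0
        ; ≤-refl; ≤-trans; <-≤-trans; ≤⇒≯; ≮⇒≥; <⇒≢; <-cmp; n<1+n; n≢0⇒n>0; m≤n⇒m≤1+n; m≤m*n; m≤n+m; m≤m⊔n; m≤n⊔m )
import Data.Nat.Tactic.RingSolver as ℕ-Solver
open import Data.Product using (Σ; ∃; ∃₂; _×_; _,_; proj₁; proj₂)
open import Data.Product.Function.NonDependent.Setoid using (_×-inverse_)
open import Data.Product.Relation.Binary.Pointwise.NonDependent using (_×ₛ_)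
open import Data.Rational as ℚ using (ℚ; 0ℚ; 1ℚ)
import Data.Rational.Properties as ℚₚ
open import Data.Rational.Unnormalised as ℚᵘ using (mkℚᵘ; *≡*)
import Data.Rational.Unnormalised.Properties as ℚᵘₚ
open import Data.Sum using (_⊎_; inj₁; inj₂; [_,_]′)
open import Data.Sum.Function.Setoid using (_⊎-inverse_)
open import Data.Sum.Relation.Binary.Pointwise using (_⊎ₛ_; inj₁; inj₂)
open import Data.Unit using (tt)
open import Function using (_∘_; id)
open import Function.Bundles using (Inverse; Injection; Bijection; Equivalence; _⇔_; mk⇔)
import Function.Construct.Composition as Composition
import Function.Construct.Symmetry as Symmetry
open import Function.Properties.Bijection using (Bijection⇒Inverse)
open import Function.Properties.Inverse using (Inverse⇒Injection)
open import Induction.WellFounded using (Acc; acc)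
open import Level using (Level; 0ℓ; Lift; lift; lower)
open import Relation.Binary.Bundles using (Setoid)
open import Relation.Binary.Construct.Closure.ReflexiveTransitive as Star using (_◅_; _◅◅_) renaming (ε to nil)
open import Relation.Binary.Definitions using (tri<; tri≈; tri>)
open import Relation.Binary.PropositionalEquality as ≡
  using (_≡_; _≢_; _≗_; refl; sym; trans; cong; cong₂; subst; subst₂; module ≡-Reasoning)
import Relation.Binary.Reasoning.Setoid as SetoidReasoning
open import Relation.Nullary using (¬_; Dec; yes; no; contradiction; does)
open import Relation.Nullary.Decidable using (map′; decidable-stable; _×-dec_; ¬?)
open import Relation.Unary using (Pred; Decidable; _∈_; _∉_; _⊆_; _≐_; _∪_; ｛_｝; U)
open import Relation.Unary.Properties using (U?)
open import Defs
open import Algebra.Properties.CommutativeMonoid.Sum *-1-commutativeMonoid using ()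
  renaming (sum to ∏; sum-cong-≗ to ∏-cong; ∑-distrib-+ to ∏-distrib-*; sum-replicate-zero to ∏-1; ∑-comm to ∏-comm)
open import Algebra.Properties.Monoid.Sum (CommutativeRing.+-monoid ℝ-commutativeRing) using () renaming (sum to ∑ᴿ)
open import Algebra.Properties.Semiring.Sum +-*-semiring using () renaming (sum to ∑ℕ)
open import Algebra.Properties.Semiring.Sum (CommutativeRing.semiring ℤₚ.+-*-commutativeRing) using ()
  renaming (sum to ∑ℤ; *-distribˡ-sum to *-distribˡ-∑ℤ; sum-cong-≗ to ∑ℤ-cong;
           ∑-distrib-+ to ∑ℤ-distrib-+; sum-replicate-zero to ∑ℤ-0)

-- Comparing powers involves cancelling, so vanishing counts are the obstacle. This is why only the
-- F → K may enter: if K → G, then composition makes all hom(F, G) positive, and equality of counts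
-- passes this on to H. The relation then forces hom(K, H) > 0, since every component type of K
-- occurs in one of the F used.
--
-- Real coefficients are never solved for. An integer vector orthogonal to all vec F is orthogonal
-- to their real combinations as well, so a vector in the real span admits no such vector, and
-- elimination must end in an integer relation.
--
-- The value (t + 1) / t is a convenience: what matters is one ratio other than 1 shared by all
-- types, so that hom(F, G) / hom(F, H) is its power with exponent z · vec F. Two graphs whose
-- counts differ at one type only differ there by an uncontrolled amount, which suitable numbers of
-- copies normalise.
--
-- Profiniteness yields finitely many types for simple K only. Looped K are treated apart: no vector
-- of a looped graph lies in the span in (2), and in (3) such a K cuts out the whole class.

private variable
  a b ℓ ℓ′ ℓ₁ ℓ₂ : Level

-- Cardinalities of finite setoids

Card : Setoid a ℓ → ℕ → Set _
Card S n = Inverse S (≡.setoid (Fin n))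

module _ {S : Setoid a ℓ} {T : Setoid b ℓ′} where

  private
    module S = Setoid S
    module T = Setoid T

  mkBijection : (f : S.Carrier → T.Carrier) → (∀ {x y} → x S.≈ y → f x T.≈ f y) →
    (∀ {x y} → f x T.≈ f y → x S.≈ y) → (∀ y → ∃ λ x → f x T.≈ y) → Bijection S T
  mkBijection f f-cong inj surj = record
    { to = f
    ; cong = f-cong
    ; bijective = inj , λ y → proj₁ (surj y) , λ z≈ → T.trans (f-cong z≈) (proj₂ (surj y))
    }

  card-bijection : ∀ {n} → Bijection S T → Card T n → Card S n
  card-bijection f t = Composition.inverse (Bijection⇒Inverse f) t

  card-bijection⁻ : ∀ {n} → Bijection S T → Card S n → Card T n
  card-bijection⁻ f s = Composition.inverse (Symmetry.inverse (Bijection⇒Inverse f)) s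

  card-injection : ∀ {m n} → Injection S T → Card S m → Card T n → m ≤ n
  card-injection f s t = injective⇒≤ (Injection.injective g)
    where g = Composition.injection (Inverse⇒Injection (Symmetry.inverse s))
                (Composition.injection f (Inverse⇒Injection t))

-- A missed value could be punched out of the codomain, leaving an injection into a set smaller than
-- the domain.
injective⇒surjective : ∀ {m n} (f : Fin m → Fin n) → (∀ {i j} → f i ≡ f j → i ≡ j) → n ≤ m →
  ∀ y → ∃ λ x → f x ≡ y
injective⇒surjective {m} {suc n} f inj n<m y with any? (λ x → f x ≟ᶠ y)
... | yes x = x
... | no ∄x = contradiction n<m (≤⇒≯ (injective⇒≤ {f = λ x → punchOut (missed x)}
  (λ {i} {j} eq → inj (punchOut-injective (missed i) (missed j) eq))))
  where
  missed : ∀ x → y ≢ f x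
  missed x eq = ∄x (x , sym eq)

card-injection-surjective : {S : Setoid a ℓ} {T : Setoid b ℓ′} → ∀ {m n} (f : Injection S T) →
  Card S m → Card T n → n ≤ m → ∀ y → ∃ λ x → Setoid._≈_ T (Injection.to f x) y
card-injection-surjective {T = T} f s t n≤m y
  with injective⇒surjective (Injection.to g) (Injection.injective g) n≤m (Inverse.to t y)
  where g = Composition.injection (Inverse⇒Injection (Symmetry.inverse s))
              (Composition.injection f (Inverse⇒Injection t))
... | i , eq = Inverse.from s i , Injection.injective (Inverse⇒Injection t) eq

module _ {S : Setoid a ℓ} where

  private module S = Setoid S

  card-unique : ∀ {m n} → Card S m → Card S n → m ≡ n
  card-unique s t = ↔⇒≡ (Composition.inverse (Symmetry.inverse s) t)

  card-inhabited : ∀ {n} → Card S n → S.Carrier → 0 < n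
  card-inhabited {zero} s x with Inverse.to s x
  ... | ()
  card-inhabited {suc n} s x = s≤s z≤n

  inhabited-card : ∀ {n} → Card S n → 0 < n → S.Carrier
  inhabited-card {suc n} s _ = Inverse.from s zero

card-equal : {S : Setoid a ℓ} {T : Setoid b ℓ′} → ∀ {m n} →
  Card S m → Card T n → Bijection S T → m ≡ n
card-equal s t f = card-unique (card-bijection⁻ f s) t

module _ {S : Setoid a ℓ} {T : Setoid b ℓ′} where

  card-× : ∀ {m n} → Card S m → Card T n → Card (S ×ₛ T) (m * n)
  card-× {m} {n} s t = Composition.inverse (s ×-inverse t)
    (record
      { to = λ { (i , j) → combine i j }
      ; from = remQuot {m} n
      ; to-cong = λ { (refl , refl) → refl }
      ; from-cong = λ { refl → refl , refl }
      ; inverse = (λ { {x} (refl , refl) → combine-remQuot {m} n x })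
                , λ { {i , j} refl → ≡.cong proj₁ (remQuot-combine i j) , ≡.cong proj₂ (remQuot-combine i j) }
      })

  card-⊎ : ∀ {m n} → Card S m → Card T n → Card (S ⊎ₛ T) (m + n)
  card-⊎ {m} {n} s t = Composition.inverse (s ⊎-inverse t)
    (record
      { to = to
      ; from = from
      ; to-cong = λ { (inj₁ refl) → refl ; (inj₂ refl) → refl }
      ; from-cong = λ { {x} refl → Setoid.refl F }
      ; inverse = (λ {x} eq → trans (to-cong eq) (inverseˡ′ x)) , λ { {x} refl → inverseʳ′ x }
      })
    where
    F = ≡.setoid (Fin m) ⊎ₛ ≡.setoid (Fin n)
    open Inverse (Symmetry.inverse (+↔⊎ {m} {n})) using (to; from; strictlyInverseˡ; strictlyInverseʳ)
    to-cong : ∀ {x y} → Setoid._≈_ F x y → to x ≡ to y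
    to-cong (inj₁ refl) = refl
    to-cong (inj₂ refl) = refl
    inverseˡ′ : ∀ x → to (from x) ≡ x
    inverseˡ′ = strictlyInverseˡ
    inverseʳ′ : ∀ x → Setoid._≈_ F (from (to x)) x
    inverseʳ′ x = Setoid.reflexive F (strictlyInverseʳ x)

Πₛ : ∀ {n} → (Fin n → Setoid a ℓ) → Setoid a ℓ
Πₛ S = record
  { Carrier = ∀ i → Setoid.Carrier (S i)
  ; _≈_ = λ f g → ∀ i → Setoid._≈_ (S i) (f i) (g i)
  ; isEquivalence = record
    { refl = λ i → Setoid.refl (S i)
    ; sym = λ f≈g i → Setoid.sym (S i) (f≈g i)
    ; trans = λ f≈g g≈h i → Setoid.trans (S i) (f≈g i) (g≈h i)
    }
  }

card-Π : ∀ {n} {S : Fin n → Setoid a ℓ} {c : Fin n → ℕ} → (∀ i → Card (S i) (c i)) → Card (Πₛ S) (∏ c)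
card-Π {n = zero} s = record
  { to = λ _ → zero
  ; from = λ _ ()
  ; to-cong = λ _ → refl
  ; from-cong = λ _ ()
  ; inverse = (λ { {zero} _ → refl }) , λ _ ()
  }
card-Π {n = suc n} {S} s = card-bijection
  (mkBijection {T = S zero ×ₛ Πₛ (S ∘ suc)} (λ f → f zero , f ∘ suc)
    (λ f≈g → f≈g zero , f≈g ∘ suc)
    (λ { (eq , eqs) zero → eq ; (eq , eqs) (suc i) → eqs i })
    (λ { (x , g) → (λ { zero → x ; (suc i) → g i }) , Setoid.refl (S zero) , λ i → Setoid.refl (S (suc i)) }))
  (card-× (s zero) (card-Π (s ∘ suc)))

lookup-injective : ∀ {A : Set a} {xs : List A} → Unique xs → ∀ i j → lookup xs i ≡ lookup xs j → i ≡ j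
lookup-injective (x∉ ∷ u) zero zero eq = refl
lookup-injective {xs = _ ∷ xs} (x∉ ∷ u) zero (suc j) eq = contradiction eq (All.lookup x∉ (∈-lookup {xs = xs} j))
lookup-injective {xs = _ ∷ xs} (x∉ ∷ u) (suc i) zero eq = contradiction (sym eq) (All.lookup x∉ (∈-lookup {xs = xs} i))
lookup-injective (x∉ ∷ u) (suc i) (suc j) eq = cong suc (lookup-injective u i j eq)

module _ {n} {P : Pred (Fin n) ℓ₁} (P? : Decidable P) where

  members : List (Fin n)
  members = filter P? (allFin n)

  members-unique : Unique members
  members-unique = filter⁺ P? (allFin⁺ n)

  members-injective : ∀ i j → lookup members i ≡ lookup members j → i ≡ j
  members-injective = lookup-injective members-unique

  member : ∀ i → P (lookup members i)
  member i = proj₂ (∈-filter⁻ P? {xs = allFin n} (∈-lookup {xs = members} i))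

  memberIndex : ∀ {v} → P v → ∃ λ i → lookup members i ≡ v
  memberIndex Pv = Any.index v∈ , sym (lookup-index v∈)
    where v∈ = ∈-filter⁺ P? (∈-allFin _) Pv

  Subₛ : Setoid ℓ₁ 0ℓ
  Subₛ = record
    { Carrier = ∃ P
    ; _≈_ = λ x y → proj₁ x ≡ proj₁ y
    ; isEquivalence = record { refl = refl ; sym = sym ; trans = trans }
    }

  card-count : Card Subₛ (count P?)
  card-count = Symmetry.inverse (Bijection⇒Inverse (mkBijection {T = Subₛ}
    (λ i → lookup members i , member i)
    (cong (lookup members))
    (λ {i} {j} → members-injective i j)
    (λ { (v , Pv) → memberIndex Pv })))

count-≐ : ∀ {n} {P : Pred (Fin n) ℓ₁} {Q : Pred (Fin n) ℓ₂} (P? : Decidable P) (Q? : Decidable Q) →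
  P ≐ Q → count P? ≡ count Q?
count-≐ P? Q? P≐Q = cong length (filter-≐ P? Q? P≐Q (allFin _))

count-split : ∀ {n} {P : Pred (Fin n) ℓ₁} {Q : Pred (Fin n) ℓ₂} (P? : Decidable P) (Q? : Decidable Q) →
  count (λ i → P? i ×-dec Q? i) + count (λ i → P? i ×-dec ¬? (Q? i)) ≡ count P?
count-split P? Q? = go (allFin _)
  where
  go : ∀ xs → length (filter (λ i → P? i ×-dec Q? i) xs) + length (filter (λ i → P? i ×-dec ¬? (Q? i)) xs)
    ≡ length (filter P? xs)
  go [] = refl
  go (x ∷ xs) with P? x | Q? x
  ... | no _  | _     = go xs
  ... | yes _ | yes _ = cong suc (go xs)
  ... | yes _ | no _  = trans (+-suc _ _) (cong suc (go xs))

-- Homomorphism counts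

module _ {m n} (P : Pred (Fin m → Fin n) ℓ₁) where

  Funₛ : Setoid ℓ₁ 0ℓ
  Funₛ = record
    { Carrier = ∃ P
    ; _≈_ = λ f g → proj₁ f ≗ proj₁ g
    ; isEquivalence = record
      { refl = λ _ → refl ; sym = λ eq v → sym (eq v) ; trans = λ eq eq′ v → trans (eq v) (eq′ v) }
    }

funToFin-cong : ∀ {m n} {f g : Fin m → Fin n} → f ≗ g → funToFin f ≡ funToFin g
funToFin-cong {zero}  f≗g = refl
funToFin-cong {suc m} f≗g = cong₂ combine (f≗g zero) (funToFin-cong (f≗g ∘ suc))

finToFun-injective : ∀ {m n} {i j : Fin (n ^ m)} → finToFun {n} {m} i ≗ finToFun j → i ≡ j
finToFun-injective {m} {n} {i} {j} eq = begin
  i                              ≡⟨ funToFin-finToFin {m} i ⟨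
  funToFin (finToFun {n} {m} i)  ≡⟨ funToFin-cong eq ⟩
  funToFin (finToFun {n} {m} j)  ≡⟨ funToFin-finToFin {m} j ⟩
  j                              ∎
  where open ≡-Reasoning

-- `finToFun` inverts `funToFin` only pointwise, hence the condition that P respects pointwise
-- equality.
card-fun : ∀ {m n} {P : Pred (Fin m → Fin n) ℓ₁} (P? : Decidable P) → (∀ {f g} → f ≗ g → P f → P g) →
  Card (Funₛ P) (count {n = n ^ m} (P? ∘ finToFun))
card-fun {P = P} P? resp = card-bijection⁻ (mkBijection {S = Subₛ (P? ∘ finToFun)} {T = Funₛ P}
  (λ { (i , h) → finToFun i , h })
  (λ { refl _ → refl })
  finToFun-injective
  (λ { (f , h) → (funToFin f , resp (λ v → sym (finToFun-funToFin f v)) h) , finToFun-funToFin f }))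
  (card-count (P? ∘ finToFun))

_→ₕ_ : Graph → Graph → Set
F →ₕ G = ∃ (IsHom F G)

Homₛ : Graph → Graph → Setoid 0ℓ 0ℓ
Homₛ F G = Funₛ (IsHom F G)

IsHom-resp : ∀ F G {f g : Vertex F → Vertex G} → f ≗ g → IsHom F G f → IsHom F G g
IsHom-resp F G f≗g hom u v u~v = subst₂ (λ x y → T (adj G x y)) (f≗g u) (f≗g v) (hom u v u~v)

card-hom : ∀ F G → Card (Homₛ F G) (hom F G)
card-hom F G = card-fun (isHom? F G) (IsHom-resp F G)

-- Operations on graphs

→ₕ-pos : ∀ {F G} → F →ₕ G → 0 < hom F G
→ₕ-pos {F} {G} f = card-inhabited {S = Homₛ F G} (card-hom F G) f

pos-→ₕ : ∀ {F G} → 0 < hom F G → F →ₕ G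
pos-→ₕ {F} {G} = inhabited-card {S = Homₛ F G} (card-hom F G)

→ₕ-id : ∀ F → F →ₕ F
→ₕ-id F = id , λ _ _ → id

→ₕ-trans : ∀ {F G H} → F →ₕ G → G →ₕ H → F →ₕ H
→ₕ-trans (f , f-hom) (g , g-hom) = g ∘ f , λ u v u~v → g-hom (f u) (f v) (f-hom u v u~v)

≅-refl : ∀ {G} → G ≅ G
≅-refl = idₚ , λ _ _ → refl

≅-sym : ∀ {G H} → G ≅ H → H ≅ G
≅-sym {G} {H} (π , iso) = flip π , λ u v →
  trans (cong₂ (adj H) (sym (inverseʳ π)) (sym (inverseʳ π))) (sym (iso (π ⟨$⟩ˡ u) (π ⟨$⟩ˡ v)))

≅-trans : ∀ {G H K} → G ≅ H → H ≅ K → G ≅ K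
≅-trans (π , iso) (ρ , iso′) = π ∘ₚ ρ , λ u v → trans (iso u v) (iso′ (π ⟨$⟩ʳ u) (π ⟨$⟩ʳ v))

≅-→ₕ : ∀ {G H} → G ≅ H → G →ₕ H
≅-→ₕ (π , iso) = π ⟨$⟩ʳ_ , λ u v → subst T (iso u v)

hom-≅ : ∀ {F F′} G → F ≅ F′ → hom F G ≡ hom F′ G
hom-≅ {F} {F′} G F≅F′@(π , _) = card-equal {S = Homₛ F G} {T = Homₛ F′ G} (card-hom F G) (card-hom F′ G)
  (mkBijection
    (→ₕ-trans {F′} {F} {G} (≅-→ₕ {F′} {F} (≅-sym {F} {F′} F≅F′)))
    (λ f≗g → f≗g ∘ (π ⟨$⟩ˡ_))
    (λ {f} {g} eq v → trans (cong (proj₁ f) (sym (inverseˡ π))) (trans (eq (π ⟨$⟩ʳ v)) (cong (proj₁ g) (inverseˡ π))))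
    (λ g → →ₕ-trans {F} {F′} {G} (≅-→ₕ {F} {F′} F≅F′) g , λ v → cong (proj₁ g) (inverseʳ π)))

infixl 7 _×ᴳ_
_×ᴳ_ : Graph → Graph → Graph
G ×ᴳ H = record
  { order   = order G * order H
  ; adj     = λ x y → adj G (fst x) (fst y) ∧ adj H (snd x) (snd y)
  ; adj-sym = λ x y → cong₂ _∧_ (adj-sym G (fst x) (fst y)) (adj-sym H (snd x) (snd y))
  }
  where
  fst = proj₁ ∘ remQuot {order G} (order H)
  snd = proj₂ ∘ remQuot {order G} (order H)

hom-× : ∀ F G H → hom F (G ×ᴳ H) ≡ hom F G * hom F H
hom-× F G H = card-equal {S = Homₛ F (G ×ᴳ H)} {T = Homₛ F G ×ₛ Homₛ F H}
  (card-hom F (G ×ᴳ H)) (card-× (card-hom F G) (card-hom F H))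
  (mkBijection
    (λ { (f , h) →
        (proj₁ ∘ rq ∘ f , λ u v u~v → proj₁ (to T-∧ (h u v u~v)))
      , (proj₂ ∘ rq ∘ f , λ u v u~v → proj₂ (to T-∧ (h u v u~v))) })
    (λ eq → cong (proj₁ ∘ rq) ∘ eq , cong (proj₂ ∘ rq) ∘ eq)
    (λ { {f , _} {g , _} (eq₁ , eq₂) v → trans (sym (combine-remQuot {order G} (order H) (f v)))
        (trans (cong₂ combine (eq₁ v) (eq₂ v)) (combine-remQuot {order G} (order H) (g v))) })
    (λ { ((f , f-hom) , (g , g-hom)) →
        ( (λ v → combine (f v) (g v))
        , λ u v u~v → from T-∧
          ( subst₂ (λ x y → T (adj G x y)) (sym (fst (f u) (g u))) (sym (fst (f v) (g v))) (f-hom u v u~v)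
          , subst₂ (λ x y → T (adj H x y)) (sym (snd (f u) (g u))) (sym (snd (f v) (g v))) (g-hom u v u~v) ) )
      , (λ v → fst (f v) (g v)) , (λ v → snd (f v) (g v)) }))
  where
  open Equivalence using (to; from)
  rq = remQuot {order G} (order H)
  fst : ∀ x y → proj₁ (rq (combine x y)) ≡ x
  fst x y = cong proj₁ (remQuot-combine {order G} x y)
  snd : ∀ x y → proj₂ (rq (combine x y)) ≡ y
  snd x y = cong proj₂ (remQuot-combine {order G} x y)

×ᴳ-simple : ∀ G {K} → Simple K → Simple (G ×ᴳ K)
×ᴳ-simple G {K} simple x
  rewrite simple (proj₂ (remQuot {order G} (order K) x))
  with adj G (proj₁ (remQuot {order G} (order K) x)) (proj₁ (remQuot {order G} (order K) x))
... | true  = refl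
... | false = refl

-- The unit of the categorical product.
loop : Graph
loop = record { order = 1 ; adj = λ _ _ → true ; adj-sym = λ _ _ → refl }

hom-loop : ∀ F → hom F loop ≡ 1
hom-loop F = card-unique {S = Homₛ F loop} (card-hom F loop) (record
  { to = λ _ → zero
  ; from = λ _ → (λ _ → zero) , λ _ _ _ → tt
  ; to-cong = λ _ → refl
  ; from-cong = λ _ _ → refl
  ; inverse = (λ { {zero} _ → refl }) , λ { {f , _} _ v → unique (f v) }
  })
  where
  unique : ∀ (x : Fin 1) → zero ≡ x
  unique zero = refl

infixr 8 _^ᴳ_
_^ᴳ_ : Graph → ℕ → Graph
G ^ᴳ zero  = loop
G ^ᴳ suc n = G ×ᴳ G ^ᴳ n

hom-^ : ∀ F G n → hom F (G ^ᴳ n) ≡ hom F G ^ n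
hom-^ F G zero    = hom-loop F
hom-^ F G (suc n) = trans (hom-× F G (G ^ᴳ n)) (cong (hom F G *_) (hom-^ F G n))

∏ᴳ : ∀ {n} → (Fin n → Graph) → Graph
∏ᴳ {zero}  G = loop
∏ᴳ {suc n} G = G zero ×ᴳ ∏ᴳ (G ∘ suc)

hom-∏ : ∀ F {n} (G : Fin n → Graph) → hom F (∏ᴳ G) ≡ ∏ (hom F ∘ G)
hom-∏ F {zero}  G = hom-loop F
hom-∏ F {suc n} G = trans (hom-× F (G zero) (∏ᴳ (G ∘ suc))) (cong (hom F (G zero) *_) (hom-∏ F (G ∘ suc)))

-- Connected graphs and disjoint unions

Connected : Graph → Set
Connected G = ∃ λ v → ∀ u → Reachable G v u

Reachable-sym : ∀ G {u v} → Reachable G u v → Reachable G v u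
Reachable-sym G = Star.reverse (λ {u} {v} → subst T (adj-sym G u v))

Reachable-map : ∀ {G H} (f : G →ₕ H) {u v} → Reachable G u v → Reachable H (proj₁ f u) (proj₁ f v)
Reachable-map (f , f-hom) = Star.gmap f (λ {u} {v} → f-hom u v)

≅-connected : ∀ {G H} → G ≅ H → Connected G → Connected H
≅-connected {G} {H} G≅H@(π , _) (v , reach) = π ⟨$⟩ʳ v , λ u →
  subst (Reachable H (π ⟨$⟩ʳ v)) (inverseʳ π) (Reachable-map {G} {H} (≅-→ₕ {G} {H} G≅H) (reach (π ⟨$⟩ˡ u)))

-- A walk of G out of v visits only vertices reachable from v, so each of its steps stays in the
-- component.
component-connected : ∀ G v → Connected (component G v)
component-connected G v with memberIndex (reachable? G v) {v} nil
... | root , root≡v = root , λ u → walk (subst (λ w → Reachable G w _) (sym root≡v) (member (reachable? G v) u)) refl refl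
  where
  vs = members (reachable? G v)
  walk : ∀ {i j x y} → Reachable G x y → lookup vs i ≡ x → lookup vs j ≡ y → Reachable (component G v) i j
  walk {i} {j} nil refl eq with members-injective (reachable? G v) i j (sym eq)
  ... | refl = nil
  walk {i} (_◅_ {j = w} x~w w⋯y) refl eq
    with memberIndex (reachable? G v) (member (reachable? G v) i ◅◅ (x~w ◅ nil))
  ... | k , k≡w = subst (λ z → T (adj G (lookup vs i) z)) (sym k≡w) x~w ◅ walk w⋯y k≡w eq

infixl 6 _⊔ᴳ_
_⊔ᴳ_ : Graph → Graph → Graph
G ⊔ᴳ H = record
  { order   = order G + order H
  ; adj     = λ x y → adj′ (splitAt (order G) x) (splitAt (order G) y)
  ; adj-sym = λ x y → adj′-sym (splitAt (order G) x) (splitAt (order G) y)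
  }
  where
  adj′ : Vertex G ⊎ Vertex H → Vertex G ⊎ Vertex H → Bool
  adj′ (inj₁ u) (inj₁ v) = adj G u v
  adj′ (inj₁ u) (inj₂ v) = false
  adj′ (inj₂ u) (inj₁ v) = false
  adj′ (inj₂ u) (inj₂ v) = adj H u v
  adj′-sym : ∀ u v → adj′ u v ≡ adj′ v u
  adj′-sym (inj₁ u) (inj₁ v) = adj-sym G u v
  adj′-sym (inj₁ u) (inj₂ v) = refl
  adj′-sym (inj₂ u) (inj₁ v) = refl
  adj′-sym (inj₂ u) (inj₂ v) = adj-sym H u v

module _ (G H : Graph) where

  private
    m = order G
    n = order H
    inl : Vertex G → Vertex (G ⊔ᴳ H)
    inl x = x ↑ˡ n
    inr : Vertex H → Vertex (G ⊔ᴳ H)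
    inr y = m ↑ʳ y

    adj-inl : ∀ u v → adj (G ⊔ᴳ H) (inl u) (inl v) ≡ adj G u v
    adj-inl u v rewrite splitAt-↑ˡ m u n | splitAt-↑ˡ m v n = refl

    adj-inr : ∀ u v → adj (G ⊔ᴳ H) (inr u) (inr v) ≡ adj H u v
    adj-inr u v rewrite splitAt-↑ʳ m n u | splitAt-↑ʳ m n v = refl

    adj-inl-inr : ∀ u v → adj (G ⊔ᴳ H) (inl u) (inr v) ≡ false
    adj-inl-inr u v rewrite splitAt-↑ˡ m u n | splitAt-↑ʳ m n v = refl

    inl≢inr : ∀ u v → inl u ≢ inr v
    inl≢inr u v eq with trans (sym (splitAt-↑ˡ m u n)) (trans (cong (splitAt m) eq) (splitAt-↑ʳ m n v))
    ... | ()

    side : ∀ w → (∃ λ x → inl x ≡ w) ⊎ (∃ λ y → inr y ≡ w)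
    side w with splitAt m w in eq
    ... | inj₁ x = inj₁ (x , splitAt⁻¹-↑ˡ eq)
    ... | inj₂ y = inj₂ (y , splitAt⁻¹-↑ʳ eq)

  -- No edge joins the two sides, so a connected F maps entirely to the side that contains the image
  -- of its root.
  hom-⊔ : ∀ F → Connected F → hom F (G ⊔ᴳ H) ≡ hom F G + hom F H
  hom-⊔ F (root , reach) = sym (card-equal {S = Homₛ F G ⊎ₛ Homₛ F H} {T = Homₛ F (G ⊔ᴳ H)}
    (card-⊎ (card-hom F G) (card-hom F H)) (card-hom F (G ⊔ᴳ H))
    (mkBijection to to-cong (λ {x} {y} → to-injective x y) to-surjective))
    where
    to : F →ₕ G ⊎ F →ₕ H → F →ₕ (G ⊔ᴳ H)
    to (inj₁ (f , h)) = inl ∘ f , λ u v u~v → subst T (sym (adj-inl (f u) (f v))) (h u v u~v)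
    to (inj₂ (f , h)) = inr ∘ f , λ u v u~v → subst T (sym (adj-inr (f u) (f v))) (h u v u~v)

    to-cong : ∀ {x y} → Setoid._≈_ (Homₛ F G ⊎ₛ Homₛ F H) x y → proj₁ (to x) ≗ proj₁ (to y)
    to-cong (inj₁ eq) v = cong inl (eq v)
    to-cong (inj₂ eq) v = cong inr (eq v)

    to-injective : ∀ x y → proj₁ (to x) ≗ proj₁ (to y) → Setoid._≈_ (Homₛ F G ⊎ₛ Homₛ F H) x y
    to-injective (inj₁ f) (inj₁ g) eq = inj₁ λ v → ↑ˡ-injective n _ _ (eq v)
    to-injective (inj₁ f) (inj₂ g) eq = contradiction (eq root) (inl≢inr _ _)
    to-injective (inj₂ f) (inj₁ g) eq = contradiction (sym (eq root)) (inl≢inr _ _)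
    to-injective (inj₂ f) (inj₂ g) eq = inj₂ λ v → ↑ʳ-injective m _ _ (eq v)

    to-surjective : ∀ g → ∃ λ x → proj₁ (to x) ≗ proj₁ g
    to-surjective (g , h) with side (g root)
    ... | inj₁ left = inj₁ ((λ v → proj₁ (lefts v))
          , λ u v u~v → subst T
            (trans (cong₂ (adj (G ⊔ᴳ H)) (sym (proj₂ (lefts u))) (sym (proj₂ (lefts v)))) (adj-inl _ _)) (h u v u~v))
        , λ v → proj₂ (lefts v)
      where
      walk : ∀ {u v} → Reachable F u v → (∃ λ x → inl x ≡ g u) → ∃ λ x → inl x ≡ g v
      walk nil x = x
      walk (_◅_ {i = u} {j = w} u~w w⋯v) (x , x≡) with side (g w)
      ... | inj₁ l = walk w⋯v l
      ... | inj₂ (y , y≡) = ⊥-elim (subst T (trans (cong₂ (adj (G ⊔ᴳ H)) (sym x≡) (sym y≡)) (adj-inl-inr x y)) (h u w u~w))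
      lefts : ∀ v → ∃ λ x → inl x ≡ g v
      lefts v = walk (reach v) left
    ... | inj₂ right = inj₂ ((λ v → proj₁ (rights v))
          , λ u v u~v → subst T
            (trans (cong₂ (adj (G ⊔ᴳ H)) (sym (proj₂ (rights u))) (sym (proj₂ (rights v)))) (adj-inr _ _)) (h u v u~v))
        , λ v → proj₂ (rights v)
      where
      walk : ∀ {u v} → Reachable F u v → (∃ λ x → inr x ≡ g u) → ∃ λ x → inr x ≡ g v
      walk nil x = x
      walk (_◅_ {i = u} {j = w} u~w w⋯v) (x , x≡) with side (g w)
      ... | inj₂ r = walk w⋯v r
      ... | inj₁ (y , y≡) = ⊥-elim (subst T
        (trans (cong₂ (adj (G ⊔ᴳ H)) (sym x≡) (sym y≡)) (trans (adj-sym (G ⊔ᴳ H) (inr x) (inl y)) (adj-inl-inr y x)))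
        (h u w u~w))
      rights : ∀ v → ∃ λ x → inr x ≡ g v
      rights v = walk (reach v) right

infixr 8 _·ᴳ_
_·ᴳ_ : ℕ → Graph → Graph
zero  ·ᴳ G = record { order = 0 ; adj = λ () ; adj-sym = λ () }
suc n ·ᴳ G = G ⊔ᴳ n ·ᴳ G

hom-· : ∀ F → Connected F → ∀ n G → hom F (n ·ᴳ G) ≡ n * hom F G
hom-· F conn (suc n) G = trans (hom-⊔ G (n ·ᴳ G) F conn) (cong (λ m → hom F G + m) (hom-· F conn n G))
-- `Connected` provides a vertex, so F has no map to the empty graph; an empty F would have exactly
-- one.
hom-· F (root , _) zero G with hom F (zero ·ᴳ G) in eq
... | zero  = refl
... | suc n with proj₁ (pos-→ₕ {F} {zero ·ᴳ G} (subst (0 <_) (sym eq) (s≤s z≤n))) root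
... | ()

-- Homomorphism counts determine a graph

Hits : ∀ {m n} → (Fin m → Fin n) → Pred (Fin n) 0ℓ
Hits f y = ∃ λ x → f x ≡ y

module _ (D : Graph) where

  -- A is the set of permitted and S the list of prescribed image vertices. Keeping them apart
  -- allows induction on S while A shrinks.
  HomInto : ∀ F → Pred (Vertex D) 0ℓ → List (Vertex D) → Pred (Vertex F → Vertex D) 0ℓ
  HomInto F A S f = IsHom F D f × (∀ u → A (f u)) × All (Hits f) S

  module _ (F : Graph) {A : Pred (Vertex D) 0ℓ} (A? : Decidable A) where

    homInto? : ∀ S → Decidable (HomInto F A S)
    homInto? S f = isHom? F D f ×-dec all? (λ u → A? (f u)) ×-dec All.all? (λ v → any? λ u → f u ≟ᶠ v) S

    homInto : List (Vertex D) → ℕ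
    homInto S = count {n = order D ^ order F} (homInto? S ∘ finToFun)

    HomInto-resp : ∀ {S} {f g} → f ≗ g → HomInto F A S f → HomInto F A S g
    HomInto-resp f≗g (h , in-A , hits) = IsHom-resp F D f≗g h
      , (λ u → subst A (f≗g u) (in-A u)) , All.map (λ { (u , fu≡) → u , trans (sym (f≗g u)) fu≡ }) hits

    card-homInto : ∀ S → Card (Funₛ (HomInto F A S)) (homInto S)
    card-homInto S = card-fun (homInto? S) (HomInto-resp {S})

    homInto-[] : homInto [] ≡ hom F (induced D (members A?))
    homInto-[] = sym (card-equal {S = Homₛ F (induced D (members A?))} {T = Funₛ (HomInto F A [])}
      (card-hom F (induced D (members A?))) (card-homInto [])
      (mkBijection
        (λ { (f , h) → lookup (members A?) ∘ f , h , (λ u → member A? (f u)) , [] })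
        (λ eq v → cong (lookup (members A?)) (eq v))
        (λ eq v → members-injective A? _ _ (eq v))
        (λ { (g , h , in-A , []) → let idx = λ u → memberIndex A? (in-A u) in
          ( (λ u → proj₁ (idx u))
          , λ u v u~v → subst₂ (λ x y → T (adj D x y)) (sym (proj₂ (idx u))) (sym (proj₂ (idx v))) (h u v u~v))
          , λ u → proj₂ (idx u) })))

  _−_ : {A : Pred (Vertex D) 0ℓ} → Decidable A → ∀ v → Decidable (λ u → A u × u ≢ v)
  (A? − v) u = A? u ×-dec ¬? (u ≟ᶠ v)

  -- A map into A that avoids v is a map into A without v, so splitting by whether v is hit stays
  -- within the family `homInto`.
  homInto-∷ : ∀ F {A : Pred (Vertex D) 0ℓ} (A? : Decidable A) v S →
    homInto F A? (v ∷ S) + homInto F (A? − v) S ≡ homInto F A? S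
  homInto-∷ F A? v S = trans
    (cong₂ _+_
      (count-≐ _ (λ i → homInto? F A? S (finToFun i) ×-dec hits? (finToFun i))
        ( (λ { (h , in-A , hit ∷ hits) → (h , in-A , hits) , hit })
        , λ { ((h , in-A , hits) , hit) → h , in-A , hit ∷ hits }))
      (count-≐ _ (λ i → homInto? F A? S (finToFun i) ×-dec ¬? (hits? (finToFun i)))
        ( (λ { (h , in-A , hits) → (h , proj₁ ∘ in-A , hits) , λ { (u , eq) → proj₂ (in-A u) eq } })
        , λ { ((h , in-A , hits) , ∄hit) → h , (λ u → in-A u , λ eq → ∄hit (u , eq)) , hits })))
    (count-split {n = order D ^ order F} (homInto? F A? S ∘ finToFun) (hits? ∘ finToFun))
    where
    hits? : Decidable (λ (f : Vertex F → Vertex D) → Hits f v)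
    hits? f = any? λ u → f u ≟ᶠ v

  -- Counting homomorphisms into the induced subgraphs of D is enough to count,
  -- by inclusion–exclusion, those that hit prescribed vertices.
  homInto-determined : ∀ F F′ → (∀ G → hom F G ≡ hom F′ G) →
    ∀ S {A : Pred (Vertex D) 0ℓ} (A? : Decidable A) → homInto F A? S ≡ homInto F′ A? S
  homInto-determined F F′ eq []      A? = trans (homInto-[] F A?) (trans (eq (induced D (members A?))) (sym (homInto-[] F′ A?)))
  homInto-determined F F′ eq (v ∷ S) A? = +-cancelʳ-≡ (homInto F (A? − v) S) _ _ (begin
    homInto F A? (v ∷ S) + homInto F (A? − v) S    ≡⟨ homInto-∷ F A? v S ⟩
    homInto F A? S                                 ≡⟨ homInto-determined F F′ eq S A? ⟩
    homInto F′ A? S                                ≡⟨ homInto-∷ F′ A? v S ⟨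
    homInto F′ A? (v ∷ S) + homInto F′ (A? − v) S  ≡⟨ cong (λ m → homInto F′ A? (v ∷ S) + m) (homInto-determined F F′ eq S (A? − v)) ⟨
    homInto F′ A? (v ∷ S) + homInto F (A? − v) S   ∎)
    where open ≡-Reasoning

-- Surjective homomorphisms in both directions

SurjectiveHom : Graph → Graph → Set
SurjectiveHom F G = ∃ λ (f : F →ₕ G) → ∀ v → Hits (proj₁ f) v

-- The identity of D hits every vertex of D, so by equality of the counts some homomorphism from C
-- does so too.
≡hom⇒surjectiveHom : ∀ C D → (∀ G → hom C G ≡ hom D G) → SurjectiveHom C D
≡hom⇒surjectiveHom C D eq = (proj₁ f , proj₁ (proj₂ f)) , λ v → All.lookup (proj₂ (proj₂ (proj₂ f))) (∈-allFin v)
  where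
  id-hits-all : HomInto D D U (allFin _) id
  id-hits-all = (λ _ _ → id) , (λ _ → tt) , All.tabulate (λ {v} _ → v , refl)
  f : ∃ (HomInto D C U (allFin _))
  f = inhabited-card {S = Funₛ (HomInto D C U (allFin _))} (card-homInto D C U? (allFin _))
    (subst (0 <_) (sym (homInto-determined D C D eq (allFin _) U?))
      (card-inhabited {S = Funₛ (HomInto D D U (allFin _))} (card-homInto D D U? (allFin _)) (id , id-hits-all)))

-- Homomorphisms from this graph to G are the arcs of G, that is, its ordered pairs of adjacent
-- vertices.
edge : Graph
edge = record { order = 2 ; adj = adj₂ ; adj-sym = adj₂-sym }
  where
  adj₂ : Fin 2 → Fin 2 → Bool
  adj₂ zero       zero       = false
  adj₂ zero       (suc zero) = true
  adj₂ (suc zero) zero       = true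
  adj₂ (suc zero) (suc zero) = false
  adj₂-sym : ∀ u v → adj₂ u v ≡ adj₂ v u
  adj₂-sym zero       zero       = refl
  adj₂-sym zero       (suc zero) = refl
  adj₂-sym (suc zero) zero       = refl
  adj₂-sym (suc zero) (suc zero) = refl

edge-hom : ∀ G {u v} → T (adj G u v) → edge →ₕ G
edge-hom G {u} {v} u~v = ends , ends-hom
  where
  ends : Fin 2 → Vertex G
  ends zero       = u
  ends (suc zero) = v
  ends-hom : IsHom edge G ends
  ends-hom zero       (suc zero) _ = u~v
  ends-hom (suc zero) zero       _ = subst T (adj-sym G u v) u~v
  ends-hom (suc zero) (suc zero) ()

module _ {C D : Graph} where

  surjective⇒order≤ : SurjectiveHom C D → order D ≤ order C
  surjective⇒order≤ (f , surj) = injective⇒≤ {f = proj₁ ∘ surj}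
    (λ {x} {y} eq → trans (sym (proj₂ (surj x))) (trans (cong (proj₁ f) eq) (proj₂ (surj y))))

  -- A section of f is injective, hence onto when C is no larger than D; so f is injective as well.
  surjective⇒injective : (f : SurjectiveHom C D) → order C ≤ order D →
    ∀ {x y} → proj₁ (proj₁ f) x ≡ proj₁ (proj₁ f) y → x ≡ y
  surjective⇒injective ((f , _) , surj) C≤D {x} {y} eq
    with injective⇒surjective (proj₁ ∘ surj)
      (λ {x} {y} eq → trans (sym (proj₂ (surj x))) (trans (cong f eq) (proj₂ (surj y)))) C≤D
  ... | section-surj with section-surj x | section-surj y
  ... | x′ , refl | y′ , refl = cong (proj₁ ∘ surj) (trans (sym (proj₂ (surj x′))) (trans eq (proj₂ (surj y′))))

  edge-injection : (f : C →ₕ D) → (∀ {x y} → proj₁ f x ≡ proj₁ f y → x ≡ y) → Injection (Homₛ edge C) (Homₛ edge D)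
  edge-injection f inj = record
    { to = λ g → →ₕ-trans {edge} {C} {D} g f
    ; cong = λ eq v → cong (proj₁ f) (eq v)
    ; injective = λ eq v → inj (eq v)
    }

T⇔⇒≡ : ∀ {x y} → (T x → T y) → (T y → T x) → x ≡ y
T⇔⇒≡ {true}  {true}  _ _ = refl
T⇔⇒≡ {true}  {false} f _ with f tt
... | ()
T⇔⇒≡ {false} {true}  _ g with g tt
... | ()
T⇔⇒≡ {false} {false} _ _ = refl

surjectiveHoms⇒≅ : ∀ {C D} → SurjectiveHom C D → SurjectiveHom D C → C ≅ D
surjectiveHoms⇒≅ {C} {D} f g =
  permutation φ (proj₁ ∘ proj₂ f) (λ v → proj₂ (proj₂ f v)) (λ u → f-inj (proj₂ (proj₂ f (φ u))))
  , λ u v → T⇔⇒≡ (proj₂ (proj₁ f) u v) (reflect u v)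
  where
  φ = proj₁ (proj₁ f)
  f-inj : ∀ {x y} → φ x ≡ φ y → x ≡ y
  f-inj = surjective⇒injective {C} {D} f (surjective⇒order≤ {D} {C} g)
  g-inj = surjective⇒injective {D} {C} g (surjective⇒order≤ {C} {D} f)

  -- f embeds the arcs of C into those of D and g embeds them back, so f is onto the arcs of D.
  reflect : ∀ u v → T (adj D (φ u) (φ v)) → T (adj C u v)
  reflect u v φu~φv =
    subst₂ (λ x y → T (adj C x y)) (f-inj (proj₂ arc zero)) (f-inj (proj₂ arc (suc zero)))
      (proj₂ (proj₁ arc) zero (suc zero) tt)
    where
    to   = edge-injection {C} {D} (proj₁ f) f-inj
    from = edge-injection {D} {C} (proj₁ g) g-inj
    arc : ∃ λ (h : edge →ₕ C) → ∀ v → φ (proj₁ h v) ≡ proj₁ (edge-hom D φu~φv) v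
    arc = card-injection-surjective {T = Homₛ edge D} to (card-hom edge C) (card-hom edge D)
      (card-injection {S = Homₛ edge D} {T = Homₛ edge C} from (card-hom edge D) (card-hom edge C))
      (edge-hom D φu~φv)

-- Lovász's theorem for counts of homomorphisms out of C and D. The hypothesis is applied to the
-- induced subgraphs of C and of D.
≡hom⇒≅ : ∀ C D → (∀ G → hom C G ≡ hom D G) → C ≅ D
≡hom⇒≅ C D eq = surjectiveHoms⇒≅ {C} {D} (≡hom⇒surjectiveHom C D eq) (≡hom⇒surjectiveHom D C (sym ∘ eq))

-- Homomorphism counts and connected components

∏-single : ∀ {n} (f : Fin n → ℕ) i → (∀ j → j ≢ i → f j ≡ 1) → ∏ f ≡ f i
∏-single {suc n} f zero    eq = trans
  (cong (f zero *_) (trans (∏-cong {n} (λ j → eq (suc j) λ ())) (∏-1 n))) (*-identityʳ (f zero))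
∏-single f (suc i) eq = trans
  (cong₂ _*_ (eq zero λ ()) (∏-single (f ∘ suc) i λ j j≢i → eq (suc j) (j≢i ∘ suc-injective))) (*-identityˡ (f (suc i)))

-- A product over a list, grouped by the kinds Q j of its entries.
module _ {A : Set a} {n} {P : Pred A ℓ₁} {Q : Fin n → Pred A ℓ₂} (P? : Decidable P) (Q? : ∀ j → Decidable (Q j))
  (w : A → ℕ) (x : Fin n → ℕ)
  (kind : ∀ {v} → P v → ∃ λ j → Q j v) (kind-unique : ∀ {v i j} → Q i v → Q j v → i ≡ j)
  (w≡x : ∀ {v j} → Q j v → w v ≡ x j) where

  private
    PQ? : ∀ j → Decidable (λ v → P v × Q j v)
    PQ? j v = P? v ×-dec Q? j v

  ∏-by-kind : ∀ vs → ∏ (w ∘ lookup (filter P? vs)) ≡ ∏ (λ j → x j ^ length (filter (PQ? j) vs))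
  ∏-by-kind [] = sym (∏-1 n)
  ∏-by-kind (v ∷ vs) = case (P? v)
    where
    open ≡-Reasoning
    ∏w : List A → ℕ
    ∏w us = ∏ (w ∘ lookup us)
    y : Fin n → ℕ
    y j = x j ^ length (filter (PQ? j) vs)

    case : Dec (P v) → ∏w (filter P? (v ∷ vs)) ≡ ∏ (λ j → x j ^ length (filter (PQ? j) (v ∷ vs)))
    case (no ¬Pv) = begin
      ∏w (filter P? (v ∷ vs))                            ≡⟨ cong ∏w (filter-reject P? ¬Pv) ⟩
      ∏w (filter P? vs)                                  ≡⟨ ∏-by-kind vs ⟩
      ∏ y                                                ≡⟨ ∏-cong {n} (λ j → cong (λ us → x j ^ length us)
                                                               (sym (filter-reject (PQ? j) (¬Pv ∘ proj₁)))) ⟩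
      ∏ (λ j → x j ^ length (filter (PQ? j) (v ∷ vs)))   ∎
    case (yes Pv) = begin
      ∏w (filter P? (v ∷ vs))                            ≡⟨ cong ∏w (filter-accept P? Pv) ⟩
      w v * ∏w (filter P? vs)                            ≡⟨ cong₂ _*_ (sym ∏δ) (∏-by-kind vs) ⟩
      ∏ δ * ∏ y                                          ≡⟨ ∏-distrib-* δ y ⟨
      ∏ (λ j → δ j * y j)                                ≡⟨ ∏-cong {n} step ⟩
      ∏ (λ j → x j ^ length (filter (PQ? j) (v ∷ vs)))   ∎
      where
      -- The contribution of v to kind j, trivial unless j is the kind of v.
      δ : Fin n → ℕ
      δ j = if does (Q? j v) then x j else 1
      δ-yes : ∀ {j} → Q j v → δ j ≡ x j
      δ-yes {j} Qjv with Q? j v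
      ... | yes _   = refl
      ... | no ¬Qjv = contradiction Qjv ¬Qjv
      δ-no : ∀ {j} → ¬ Q j v → δ j ≡ 1
      δ-no {j} ¬Qjv with Q? j v
      ... | yes Qjv = contradiction Qjv ¬Qjv
      ... | no _    = refl
      ∏δ : ∏ δ ≡ w v
      ∏δ with j , Qjv ← kind Pv = trans
        (∏-single δ j (λ i i≢j → δ-no (λ Qiv → i≢j (kind-unique Qiv Qjv))))
        (trans (δ-yes Qjv) (sym (w≡x Qjv)))
      step : ∀ j → δ j * y j ≡ x j ^ length (filter (PQ? j) (v ∷ vs))
      step j = by (Q? j v)
        where
        by : Dec (Q j v) → δ j * y j ≡ x j ^ length (filter (PQ? j) (v ∷ vs))
        by (yes Qjv) = trans (cong (_* y j) (δ-yes Qjv))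
          (cong (λ us → x j ^ length us) (sym (filter-accept (PQ? j) (Pv , Qjv))))
        by (no ¬Qjv) = trans (cong (_* y j) (δ-no ¬Qjv)) (trans (*-identityˡ (y j))
          (cong (λ us → x j ^ length us) (sym (filter-reject (PQ? j) (¬Qjv ∘ proj₂)))))

-- Decomposition into components

module _ (F : Graph) where

  reachable-least : ∀ u → ∃ λ r → Reachable F r u × Least F r
  reachable-least u = go u (<-wellFounded u)
    where
    go : ∀ u → Acc _<ᶠ_ u → ∃ λ r → Reachable F r u × Least F r
    go u (acc smaller) with any? (λ w → reachable? F u w ×-dec (w <ᶠ? u))
    ... | no ∄ = u , nil , λ w u⋯w → ≮⇒≥ λ w<u → ∄ (w , u⋯w , w<u)
    ... | yes (w , u⋯w , w<u) with go w (smaller w<u)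
    ...   | r , r⋯w , least = r , r⋯w ◅◅ Reachable-sym F u⋯w , least

  roots : List (Vertex F)
  roots = members (least? F)

  root : Fin (length roots) → Vertex F
  root = lookup roots

  private
    vertex : ∀ i → Vertex (component F (root i)) → Vertex F
    vertex i = lookup (members (reachable? F (root i)))

    same-root : ∀ {i j u} → Reachable F (root i) u → Reachable F (root j) u → i ≡ j
    same-root {i} {j} i⋯u j⋯u = members-injective (least? F) i j (≤-antisym
      (member (least? F) i _ (i⋯u ◅◅ Reachable-sym F j⋯u)) (member (least? F) j _ (j⋯u ◅◅ Reachable-sym F i⋯u)))

    under : ∀ i k → Reachable F (root i) (vertex i k)
    under i = member (reachable? F (root i))

    vertex-injective : ∀ {i j k l} → vertex i k ≡ vertex j l →
      _≡_ {A = Σ (Fin (length roots)) (λ i → Vertex (component F (root i)))} (i , k) (j , l)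
    vertex-injective {i} {j} {k} {l} eq =
      from-same-root (same-root (subst (Reachable F (root i)) eq (under i k)) (under j l)) l eq
      where
      -- Matching on `refl` requires j to be a variable, with l and the equation still general.
      from-same-root : ∀ {j} → i ≡ j → ∀ l → vertex i k ≡ vertex j l → (i , k) ≡ (j , l)
      from-same-root refl l eq = cong (i ,_) (members-injective (reachable? F (root i)) k l eq)

    locate-under : ∀ i {u} → Reachable F (root i) u → ∃ λ k → vertex i k ≡ u
    locate-under i = memberIndex (reachable? F (root i))

    rootOf : ∀ u → ∃ λ i → Reachable F (root i) u
    rootOf u = let r , r⋯u , least = reachable-least u ; i , i≡r = memberIndex (least? F) least in
      i , subst (λ r → Reachable F r u) (sym i≡r) r⋯u

    locate : ∀ u → ∃ λ i → ∃ λ k → vertex i k ≡ u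
    locate u = proj₁ (rootOf u) , locate-under (proj₁ (rootOf u)) (proj₂ (rootOf u))

  module _ (G : Graph) where

    private
      Parts : Set
      Parts = ∀ i → component F (root i) →ₕ G

      restrict : F →ₕ G → Parts
      restrict (f , f-hom) i = f ∘ vertex i , λ k l → f-hom (vertex i k) (vertex i l)

      module _ (g : Parts) where

        glue-map : Vertex F → Vertex G
        glue-map u = proj₁ (g (proj₁ (locate u))) (proj₁ (proj₂ (locate u)))

        glue-vertex : ∀ i k → glue-map (vertex i k) ≡ proj₁ (g i) k
        glue-vertex i k = cong (λ (j , l) → proj₁ (g j) l) (vertex-injective (proj₂ (proj₂ (locate (vertex i k)))))

        glue-hom : IsHom F G glue-map
        glue-hom u v u~v = subst₂ (λ x y → T (adj G (glue-map x) (glue-map y))) u≡ v≡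
          (subst₂ (λ x y → T (adj G x y)) (sym (glue-vertex i k)) (sym (glue-vertex i l))
            (proj₂ (g i) k l (subst₂ (λ x y → T (adj F x y)) (sym u≡) (sym v≡) u~v)))
          where
          i = proj₁ (locate u)
          k = proj₁ (proj₂ (locate u))
          u≡ = proj₂ (proj₂ (locate u))
          -- v is located within the part that contains u, not by `locate v`, so that the edge u ~ v
          -- lies in a single part.
          v-under = locate-under i (subst (Reachable F (root i)) u≡ (under i k) ◅◅ (u~v ◅ nil))
          l = proj₁ v-under
          v≡ = proj₂ v-under

    -- The components cover F and no edge joins two of them, so homomorphisms on the components can
    -- be chosen independently and glued.
    hom-components : hom F G ≡ ∏ (λ i → hom (component F (root i)) G)
    hom-components = card-equal {S = Homₛ F G} {T = Πₛ (λ i → Homₛ (component F (root i)) G)}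
      (card-hom F G) (card-Π (λ i → card-hom (component F (root i)) G))
      (mkBijection restrict
        (λ eq i k → eq (vertex i k))
        (λ {f} {g} eq u → let i , k , u≡ = locate u in
          trans (cong (proj₁ f) (sym u≡)) (trans (eq i k) (cong (proj₁ g) u≡)))
        (λ g → (glue-map g , glue-hom g) , glue-vertex g))

record Types (n : ℕ) : Set where
  field
    type      : Fin n → Graph
    distinct  : ∀ {i j} → type i ≅ type j → i ≡ j
    connected : ∀ i → Connected (type i)

  Covers : Graph → Set
  Covers F = ∀ v → ∃ λ j → type j ≅ component F v

  -- Isomorphic components contribute equal factors, so hom(F, -) is a monomial in the counts of the
  -- types, and its exponents are the entries of vec F.
  hom-types : ∀ F → Covers F → ∀ G → hom F G ≡ ∏ (λ j → hom (type j) G ^ multiplicity F (type j))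
  hom-types F covers G = trans (hom-components F G)
    (∏-by-kind (least? F) (λ j v → type j ≅? component F v)
      (λ v → hom (component F v) G) (λ j → hom (type j) G)
      (λ {v} _ → covers v)
      (λ {v} {i} {j} i≅ j≅ → distinct (≅-trans {type i} {component F v} {type j} i≅ (≅-sym {type j} {component F v} j≅)))
      (λ {v} {j} j≅ → sym (hom-≅ {type j} {component F v} G j≅))
      (allFin (order F)))

multiplicity-≅ : ∀ F {C C′} → C ≅ C′ → multiplicity F C ≡ multiplicity F C′
multiplicity-≅ F {C} {C′} C≅C′ = count-≐
  (λ v → least? F v ×-dec (C ≅? component F v)) (λ v → least? F v ×-dec (C′ ≅? component F v))
  ( (λ {v} → λ { (least , C≅) → least , ≅-trans {C′} {C} {component F v} (≅-sym {C} {C′} C≅C′) C≅ })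
  , (λ {v} → λ { (least , C′≅) → least , ≅-trans {C} {C′} {component F v} C≅C′ C′≅ }) )

-- Both vertex lists are filtered from the same list by equivalent predicates, so the components are
-- equal and not only isomorphic.
component-≡ : ∀ F {u v} → Reachable F u v → component F u ≡ component F v
component-≡ F {u} {v} u⋯v = cong (induced F) (filter-≐ (reachable? F u) (reachable? F v)
  ((Reachable-sym F u⋯v ◅◅_) , (u⋯v ◅◅_)) (allFin (order F)))

card-multiplicity : ∀ F C → Card (Subₛ (λ v → least? F v ×-dec (C ≅? component F v))) (multiplicity F C)
card-multiplicity F C = card-count (λ v → least? F v ×-dec (C ≅? component F v))

multiplicity-component : ∀ F v → 0 < multiplicity F (component F v)
multiplicity-component F v = card-inhabited (card-multiplicity F (component F v))
  (r , least , subst (component F v ≅_) (sym (component-≡ F r⋯v)) (≅-refl {component F v}))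
  where
  r = proj₁ (reachable-least F v)
  r⋯v = proj₁ (proj₂ (reachable-least F v))
  least = proj₂ (proj₂ (reachable-least F v))

multiplicity-Γ : ∀ F {C} → 0 < multiplicity F C → C ∈ Γ F
multiplicity-Γ F {C} pos = proj₁ v , proj₂ (proj₂ v)
  where v = inhabited-card (card-multiplicity F C) pos

-- Realising ratios of homomorphism counts

-- In terms of fractions, a single factor with xⱼ / yⱼ = r / s determines ∏ x / ∏ y. Ratios are
-- cross-multiplied in this way throughout.
∏-differ : ∀ {n} (x y : Fin n → ℕ) j {r s} → (∀ i → i ≢ j → x i ≡ y i) → x j * s ≡ y j * r → ∏ x * s ≡ ∏ y * r
∏-differ {suc n} x y zero {r} {s} off on = begin
  x zero * ∏ (x ∘ suc) * s    ≡⟨ lemma (x zero) (∏ (x ∘ suc)) s ⟩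
  x zero * s * ∏ (x ∘ suc)    ≡⟨ cong₂ _*_ on (∏-cong {n} λ i → off (suc i) λ ()) ⟩
  y zero * r * ∏ (y ∘ suc)    ≡⟨ lemma (y zero) (∏ (y ∘ suc)) r ⟨
  y zero * ∏ (y ∘ suc) * r    ∎
  where
  open ≡-Reasoning
  lemma : ∀ a b c → a * b * c ≡ a * c * b
  lemma = ℕ-Solver.solve-∀
∏-differ x y (suc j) {r} {s} off on = begin
  x zero * ∏ (x ∘ suc) * s    ≡⟨ lemma (x zero) (∏ (x ∘ suc)) s ⟩
  x zero * (∏ (x ∘ suc) * s)  ≡⟨ cong₂ _*_ (off zero λ ())
                                     (∏-differ (x ∘ suc) (y ∘ suc) j (λ i i≢j → off (suc i) (i≢j ∘ suc-injective)) on) ⟩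
  y zero * (∏ (y ∘ suc) * r)  ≡⟨ lemma (y zero) (∏ (y ∘ suc)) r ⟨
  y zero * ∏ (y ∘ suc) * r    ∎
  where
  open ≡-Reasoning
  lemma : ∀ a b c → a * b * c ≡ a * (b * c)
  lemma = ℕ-Solver.solve-∀

^-distribʳ-* : ∀ k a b → (a * b) ^ k ≡ a ^ k * b ^ k
^-distribʳ-* zero    a b = refl
^-distribʳ-* (suc k) a b = trans (cong (a * b *_) (^-distribʳ-* k a b)) (lemma a b (a ^ k) (b ^ k))
  where
  lemma : ∀ a b c d → a * b * (c * d) ≡ a * c * (b * d)
  lemma = ℕ-Solver.solve-∀

∏-pos : ∀ {n} (x : Fin n → ℕ) → (∀ i → 0 < x i) → 0 < ∏ x
∏-pos {zero}  x pos = s≤s z≤n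
∏-pos {suc n} x pos = *-mono-≤ (pos zero) (∏-pos (x ∘ suc) (pos ∘ suc))

upper-bound : ∀ {n} (b : Fin n → ℕ) → ∃ λ t → ∀ i → b i ≤ t
upper-bound {zero}  b = 0 , λ ()
upper-bound {suc n} b with t , b≤t ← upper-bound (b ∘ suc) =
  b zero ⊔ t , λ { zero → m≤m⊔n _ _ ; (suc i) → ≤-trans (b≤t i) (m≤n⊔m (b zero) t) }

module _ (em : ExcludedMiddle 0ℓ) {n} (𝓣 : Types n) where
  open Types 𝓣

  -- Opaque, as the definition of hom would otherwise be unfolded at every conversion check.
  opaque
    homs : Graph → Fin n → ℕ
    homs G i = hom (type i) G

    homs≡hom : ∀ G i → homs G i ≡ hom (type i) G
    homs≡hom G i = refl

    homs-⊔ : ∀ G H i → homs (G ⊔ᴳ H) i ≡ homs G i + homs H i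
    homs-⊔ G H i = hom-⊔ G H (type i) (connected i)

    homs-· : ∀ m G i → homs (m ·ᴳ G) i ≡ m * homs G i
    homs-· m G i = hom-· (type i) (connected i) m G

    homs-× : ∀ G H i → homs (G ×ᴳ H) i ≡ homs G i * homs H i
    homs-× G H i = hom-× (type i) G H

    homs-^ : ∀ G m i → homs (G ^ᴳ m) i ≡ homs G i ^ m
    homs-^ G m i = hom-^ (type i) G m

    homs-∏ : ∀ {m} (G : Fin m → Graph) i → homs (∏ᴳ G) i ≡ ∏ (λ k → homs (G k) i)
    homs-∏ G i = hom-∏ (type i) G

    homs-loop : ∀ i → homs loop i ≡ 1
    homs-loop i = hom-loop (type i)

    homs-injective : ∀ {i j} → (∀ G → homs G i ≡ homs G j) → i ≡ j
    homs-injective {i} {j} eq = distinct (≡hom⇒≅ (type i) (type j) eq)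

  -- Counts of connected types are closed under sums and products, but making a coordinate vanish
  -- takes subtraction; hence formal differences of two graphs.
  Difference : Pred (Fin n → ℤ) 0ℓ
  Difference x = ∃₂ λ P Q → ∀ i → x i ≡ + homs P i ℤ.- + homs Q i

  difference-1 : (λ _ → + 1) ∈ Difference
  difference-1 = loop , 0 ·ᴳ loop , λ i →
    sym (cong₂ (λ a b → + a ℤ.- + b) (homs-loop i) (homs-· 0 loop i))

  difference-* : ∀ {x y} → x ∈ Difference → y ∈ Difference → (λ i → x i ℤ.* y i) ∈ Difference
  difference-* {x} {y} (P , Q , x≡) (P′ , Q′ , y≡) =
    (P ×ᴳ P′) ⊔ᴳ (Q ×ᴳ Q′) , (P ×ᴳ Q′) ⊔ᴳ (Q ×ᴳ P′) , λ i → begin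
      x i ℤ.* y i
        ≡⟨ cong₂ ℤ._*_ (x≡ i) (y≡ i) ⟩
      (+ homs P i ℤ.- + homs Q i) ℤ.* (+ homs P′ i ℤ.- + homs Q′ i)
        ≡⟨ expand (+ homs P i) (+ homs Q i) (+ homs P′ i) (+ homs Q′ i) ⟩
      (+ homs P i ℤ.* + homs P′ i ℤ.+ + homs Q i ℤ.* + homs Q′ i)
        ℤ.- (+ homs P i ℤ.* + homs Q′ i ℤ.+ + homs Q i ℤ.* + homs P′ i)
        ≡⟨ cong₂ ℤ._-_ (embed i P P′ Q Q′) (embed i P Q′ Q P′) ⟨
      + homs ((P ×ᴳ P′) ⊔ᴳ (Q ×ᴳ Q′)) i ℤ.- + homs ((P ×ᴳ Q′) ⊔ᴳ (Q ×ᴳ P′)) i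
        ∎
    where
    open ≡-Reasoning
    expand : ∀ a b c d → (a ℤ.- b) ℤ.* (c ℤ.- d) ≡ (a ℤ.* c ℤ.+ b ℤ.* d) ℤ.- (a ℤ.* d ℤ.+ b ℤ.* c)
    expand = ℤ-Solver.solve-∀
    embed : ∀ i A B C D → + homs ((A ×ᴳ B) ⊔ᴳ (C ×ᴳ D)) i ≡ + homs A i ℤ.* + homs B i ℤ.+ + homs C i ℤ.* + homs D i
    embed i A B C D = begin
      + homs ((A ×ᴳ B) ⊔ᴳ (C ×ᴳ D)) i
        ≡⟨ cong +_ (homs-⊔ (A ×ᴳ B) (C ×ᴳ D) i) ⟩
      + (homs (A ×ᴳ B) i + homs (C ×ᴳ D) i)
        ≡⟨ cong₂ (λ a b → + (a + b)) (homs-× A B i) (homs-× C D i) ⟩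
      + (homs A i * homs B i + homs C i * homs D i)
        ≡⟨ ℤₚ.pos-+ (homs A i * homs B i) (homs C i * homs D i) ⟩
      + (homs A i * homs B i) ℤ.+ + (homs C i * homs D i)
        ≡⟨ cong₂ ℤ._+_ (ℤₚ.pos-* (homs A i) (homs B i)) (ℤₚ.pos-* (homs C i) (homs D i)) ⟩
      + homs A i ℤ.* + homs B i ℤ.+ + homs C i ℤ.* + homs D i
        ∎

  -- The contrapositive of Lovász's theorem; excluded middle turns the negated universal statement
  -- into a graph.
  distinguish : ∀ {i j} → i ≢ j → ∃ λ G → homs G i ≢ homs G j
  distinguish {i} {j} i≢j = by em
    where
    by : Dec (∃ λ G → homs G i ≢ homs G j) → ∃ λ G → homs G i ≢ homs G j
    by (yes G) = G
    by (no ∄G) = contradiction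
      (homs-injective λ G → decidable-stable (homs G i ℕ.≟ homs G j) λ ≢ → ∄G (G , ≢)) i≢j

  separate : ∀ i j → i ≢ j → ∃ λ x → x ∈ Difference × x i ≢ 0ℤ × x j ≡ 0ℤ
  separate i j i≢j with G , Gi≢Gj ← distinguish i≢j =
      (λ k → + homs G j ℤ.- + homs G k)
    -- hom(Cⱼ, G) copies of `loop` realise the constant vector with this value.
    , (homs G j ·ᴳ loop , G , λ k → cong (λ a → + a ℤ.- + homs G k) (sym (begin
        homs (homs G j ·ᴳ loop) k  ≡⟨ homs-· (homs G j) loop k ⟩
        homs G j * homs loop k     ≡⟨ cong (homs G j *_) (homs-loop k) ⟩
        homs G j * 1               ≡⟨ *-identityʳ (homs G j) ⟩
        homs G j                   ∎)))
    , (λ eq → Gi≢Gj (sym (ℤₚ.+-injective (ℤₚ.i-j≡0⇒i≡j (+ homs G j) (+ homs G i) eq))))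
    , ℤₚ.i≡j⇒i-j≡0 {+ homs G j} refl
    where open ≡-Reasoning

  -- If hom(Cᵢ, G) ≠ hom(Cⱼ, G), then k ↦ hom(Cⱼ, G) − hom(Cₖ, G) vanishes at j but not at i; the
  -- product of such vectors over all j ≠ i is supported on i alone.
  isolate : ∀ i js → ∃ λ x → x ∈ Difference × x i ≢ 0ℤ × All (λ j → j ≢ i → x j ≡ 0ℤ) js
  isolate i [] = (λ _ → + 1) , difference-1 , (λ ()) , []
  isolate i (j ∷ js) with isolate i js | j ≟ᶠ i
  ... | x , x∈ , xi≢0 , vanish | yes refl = x , x∈ , xi≢0 , (λ j≢j → contradiction refl j≢j) ∷ vanish
  ... | x , x∈ , xi≢0 , vanish | no j≢i with separate i j (j≢i ∘ sym)
  ...   | y , y∈ , yi≢0 , yj≡0 = (λ k → y k ℤ.* x k) , difference-* y∈ x∈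
        , (λ eq → [ yi≢0 , xi≢0 ]′ (ℤₚ.i*j≡0⇒i≡0∨j≡0 (y i) eq))
        , (λ _ → trans (cong (ℤ._* x j) yj≡0) (ℤₚ.*-zeroˡ (x j)))
          ∷ All.map (λ {k} x≡0 k≢i → trans (cong (y k ℤ.*_) (x≡0 k≢i)) (ℤₚ.*-zeroʳ (y k))) vanish

  -- Changing the count of a single type

  record Perturbation (i : Fin n) : Set where
    field
      more less : Graph
      excess    : ℕ
      at        : homs more i ≡ homs less i + suc excess
      off       : ∀ j → j ≢ i → homs more j ≡ homs less j

  -- The isolated vector is the difference of the counts of P and Q; its sign at i is not known and
  -- decides which of them is `more`.
  perturbation : ∀ i → Perturbation i
  perturbation i with isolate i (allFin n)
  ... | x , (P , Q , x≡) , xi≢0 , vanish = by (<-cmp (homs P i) (homs Q i))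
    where
    off : ∀ j → j ≢ i → homs P j ≡ homs Q j
    off j j≢i = ℤₚ.+-injective (ℤₚ.i-j≡0⇒i≡j (+ homs P j) (+ homs Q j)
      (trans (sym (x≡ j)) (All.lookup vanish (∈-allFin j) j≢i)))
    exceed : ∀ {a b} → a < b → ∃ λ e → b ≡ a + suc e
    exceed {a} {b} a<b with e , eq ← m≤n⇒∃[o]m+o≡n a<b = e , trans (sym eq) (sym (+-suc a e))
    by : _ → Perturbation i
    by (tri< P<Q _ _) = record { more = Q ; less = P ; at = proj₂ (exceed P<Q) ; off = λ j j≢i → sym (off j j≢i) }
    by (tri> _ _ Q<P) = record { more = P ; less = Q ; at = proj₂ (exceed Q<P) ; off = off }
    by (tri≈ _ P≡Q _) = contradiction (trans (x≡ i) (ℤₚ.i≡j⇒i-j≡0 (cong +_ P≡Q))) xi≢0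

  -- The ratio of `up` to `down` is (t + 1) / t at i and 1 at the other types. The excess of the
  -- perturbation has disappeared, so one t can serve all i.
  record Tilt (t : ℕ) (i : Fin n) : Set where
    field
      up down  : Graph
      up-pos   : ∀ j → 0 < homs up j
      down-pos : ∀ j → 0 < homs down j
      off      : ∀ j → j ≢ i → homs up j ≡ homs down j
      at       : homs up i * t ≡ homs down i * suc t

  module _ {i : Fin n} (π : Perturbation i) where
    open Perturbation π
    open ≡-Reasoning

    private
      y : ℕ
      y = suc excess
      -- Adding `loop` adds one to every count: all counts become positive and their differences are
      -- preserved.
      more⁺ = more ⊔ᴳ loop
      less⁺ = less ⊔ᴳ loop
      homs⁺ : ∀ G j → homs (G ⊔ᴳ loop) j ≡ homs G j + 1
      homs⁺ G j = trans (homs-⊔ G loop j) (cong (λ z → homs G j + z) (homs-loop j))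
      less⁺-pos : ∀ j → 0 < homs less⁺ j
      less⁺-pos j = subst (0 <_) (sym (homs⁺ less j)) (m≤n+m 1 (homs less j))
      off⁺ : ∀ j → j ≢ i → homs more⁺ j ≡ homs less⁺ j
      off⁺ j j≢i = trans (homs⁺ more j) (trans (cong (_+ 1) (off j j≢i)) (sym (homs⁺ less j)))
      at⁺ : homs more⁺ i ≡ homs less⁺ i + y
      at⁺ = trans (homs⁺ more i) (trans (cong (_+ 1) at)
        (trans (shift (homs less i) y) (cong (_+ y) (sym (homs⁺ less i)))))
        where
        shift : ∀ a c → a + c + 1 ≡ a + 1 + c
        shift = ℕ-Solver.solve-∀

    base : ℕ
    base = homs less⁺ i

    -- Out of t·y copies of less + loop, with y the excess, replace as many by more + loop as there
    -- are homomorphisms to less + loop.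
    module _ {t} (base≤t : base ≤ t) where

      private
        c = t * y ∸ base
        c+base : c + base ≡ t * y
        c+base = m∸n+n≡m (≤-trans base≤t (m≤m*n t y))
        up down : Graph
        up = (base ·ᴳ more⁺) ⊔ᴳ (c ·ᴳ less⁺)
        down = (t * y) ·ᴳ less⁺
        homs-up : ∀ j → homs up j ≡ base * homs more⁺ j + c * homs less⁺ j
        homs-up j = trans (homs-⊔ (base ·ᴳ more⁺) (c ·ᴳ less⁺) j)
          (cong₂ _+_ (homs-· base more⁺ j) (homs-· c less⁺ j))
        homs-down : ∀ j → homs down j ≡ t * y * homs less⁺ j
        homs-down j = homs-· (t * y) less⁺ j
        up-off : ∀ j → j ≢ i → homs up j ≡ homs down j
        up-off j j≢i = begin
          homs up j                                 ≡⟨ homs-up j ⟩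
          base * homs more⁺ j + c * homs less⁺ j    ≡⟨ cong (λ z → base * z + c * homs less⁺ j) (off⁺ j j≢i) ⟩
          base * homs less⁺ j + c * homs less⁺ j    ≡⟨ collect base c (homs less⁺ j) ⟩
          (c + base) * homs less⁺ j                 ≡⟨ cong (_* homs less⁺ j) c+base ⟩
          t * y * homs less⁺ j                      ≡⟨ homs-down j ⟨
          homs down j                               ∎
          where
          collect : ∀ b c x → b * x + c * x ≡ (c + b) * x
          collect = ℕ-Solver.solve-∀
        -- Each of the `base` replaced copies gains y homomorphisms, so the total t·y·base grows by
        -- y·base, the t-th part of it.
        up-at : homs up i ≡ suc t * (y * base)
        up-at = begin
          homs up i                                 ≡⟨ homs-up i ⟩
          base * homs more⁺ i + c * base            ≡⟨ cong (λ z → base * z + c * base) at⁺ ⟩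
          base * (base + y) + c * base              ≡⟨ collect base c y ⟩
          (c + base) * base + y * base              ≡⟨ cong (λ z → z * base + y * base) c+base ⟩
          t * y * base + y * base                   ≡⟨ collect′ t y base ⟩
          suc t * (y * base)                        ∎
          where
          collect : ∀ b c y → b * (b + y) + c * b ≡ (c + b) * b + y * b
          collect = ℕ-Solver.solve-∀
          collect′ : ∀ t y b → t * y * b + y * b ≡ suc t * (y * b)
          collect′ = ℕ-Solver.solve-∀
        down-pos : ∀ j → 0 < homs down j
        down-pos j = subst (0 <_) (sym (homs-down j))
          (*-mono-≤ (*-mono-≤ (<-≤-trans (less⁺-pos i) base≤t) (s≤s (z≤n {excess}))) (less⁺-pos j))
        up-pos : ∀ j → Dec (j ≡ i) → 0 < homs up j
        up-pos j (yes refl) = subst (0 <_) (sym up-at) (*-mono-≤ (s≤s (z≤n {t})) (*-mono-≤ (s≤s (z≤n {excess})) (less⁺-pos i)))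
        up-pos j (no j≢i)   = subst (0 <_) (sym (up-off j j≢i)) (down-pos j)
        up-ratio : homs up i * t ≡ homs down i * suc t
        up-ratio = begin
          homs up i * t              ≡⟨ cong (_* t) up-at ⟩
          suc t * (y * base) * t     ≡⟨ swap t y base ⟩
          t * y * base * suc t       ≡⟨ cong (_* suc t) (homs-down i) ⟨
          homs down i * suc t        ∎
          where
          swap : ∀ t y b → suc t * (y * b) * t ≡ t * y * b * suc t
          swap = ℕ-Solver.solve-∀

      tilt : Tilt t i
      tilt = record
        { up = up
        ; down = down
        ; up-pos = λ j → up-pos j (j ≟ᶠ i)
        ; down-pos = down-pos
        ; off = up-off
        ; at = up-ratio
        }

  -- Graphs with hom(Cⱼ, G) / hom(Cⱼ, H) = ((t + 1) / t) ^ (pⱼ − qⱼ).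
  record Realisation (t : ℕ) (p q : Fin n → ℕ) : Set where
    field
      G H   : Graph
      G-pos : ∀ j → 0 < homs G j
      ratio : ∀ j → homs G j * (t ^ p j * suc t ^ q j) ≡ homs H j * (suc t ^ p j * t ^ q j)

  -- Factor i affects the ratio at Cᵢ only. The `up` and `down` graphs exchange exponents between G
  -- and H, so p and q act as the positive and the negative part of one exponent. t is fixed before
  -- p and q.
  realise : ∃ λ t → ∀ p q → Realisation (suc t) p q
  realise = proj₁ bound , λ p q → record
    { G = G p q
    ; H = G q p
    ; G-pos = G-pos p q
    ; ratio = ratio p q
    }
    where
    bound = upper-bound (λ i → base (perturbation i))
    -- A t that is at least every base serves all types; the successor makes it positive.
    t = suc (proj₁ bound)
    module X i = Tilt (tilt (perturbation i) (m≤n⇒m≤1+n (proj₂ bound i)))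
    factor : (p q : Fin n → ℕ) → Fin n → Graph
    factor p q i = X.up i ^ᴳ p i ×ᴳ X.down i ^ᴳ q i
    G : (p q : Fin n → ℕ) → Graph
    G p q = ∏ᴳ (factor p q)
    homs-factor : ∀ p q j i → homs (factor p q i) j ≡ homs (X.up i) j ^ p i * homs (X.down i) j ^ q i
    homs-factor p q j i = trans (homs-× (X.up i ^ᴳ p i) (X.down i ^ᴳ q i) j)
      (cong₂ _*_ (homs-^ (X.up i) (p i) j) (homs-^ (X.down i) (q i) j))
    pow-pos : ∀ {a} → 0 < a → ∀ m → 0 < a ^ m
    pow-pos {suc a} _ m = m^n>0 (suc a) m
    G-pos : ∀ p q j → 0 < homs (G p q) j
    G-pos p q j = subst (0 <_) (sym (homs-∏ (factor p q) j)) (∏-pos _ λ i →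
      subst (0 <_) (sym (homs-factor p q j i)) (*-mono-≤ (pow-pos (X.up-pos i j) (p i)) (pow-pos (X.down-pos i j) (q i))))
    ratio : ∀ p q j → homs (G p q) j * (t ^ p j * suc t ^ q j) ≡ homs (G q p) j * (suc t ^ p j * t ^ q j)
    ratio p q j = subst₂ (λ a b → a * (t ^ p j * suc t ^ q j) ≡ b * (suc t ^ p j * t ^ q j))
      (sym (homs-∏ (factor p q) j)) (sym (homs-∏ (factor q p) j))
      (∏-differ (λ i → homs (factor p q i) j) (λ i → homs (factor q p i) j) j
        (λ i i≢j → off-diagonal i (i≢j ∘ sym)) diagonal)
      where
      open ≡-Reasoning
      u = homs (X.up j) j
      d = homs (X.down j) j
      off-diagonal : ∀ i → j ≢ i → homs (factor p q i) j ≡ homs (factor q p i) j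
      off-diagonal i j≢i = begin
        homs (factor p q i) j                                ≡⟨ homs-factor p q j i ⟩
        homs (X.up i) j ^ p i * homs (X.down i) j ^ q i      ≡⟨ cong₂ (λ a b → a ^ p i * b ^ q i) (X.off i j j≢i) (sym (X.off i j j≢i)) ⟩
        homs (X.down i) j ^ p i * homs (X.up i) j ^ q i      ≡⟨ *-comm (homs (X.down i) j ^ p i) _ ⟩
        homs (X.up i) j ^ q i * homs (X.down i) j ^ p i      ≡⟨ homs-factor q p j i ⟨
        homs (factor q p i) j                                ∎
      regroup : ∀ a b c d → a * b * (c * d) ≡ (a * c) * (b * d)
      regroup = ℕ-Solver.solve-∀
      regroup′ : ∀ a b c d → (a * b) * (c * d) ≡ (c * a) * (b * d)
      regroup′ = ℕ-Solver.solve-∀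
      diagonal : homs (factor p q j) j * (t ^ p j * suc t ^ q j) ≡ homs (factor q p j) j * (suc t ^ p j * t ^ q j)
      diagonal = begin
        homs (factor p q j) j * (t ^ p j * suc t ^ q j)        ≡⟨ cong (_* (t ^ p j * suc t ^ q j)) (homs-factor p q j j) ⟩
        u ^ p j * d ^ q j * (t ^ p j * suc t ^ q j)            ≡⟨ regroup (u ^ p j) (d ^ q j) (t ^ p j) (suc t ^ q j) ⟩
        (u ^ p j * t ^ p j) * (d ^ q j * suc t ^ q j)          ≡⟨ cong₂ _*_ (^-distribʳ-* (p j) u t) (^-distribʳ-* (q j) d (suc t)) ⟨
        (u * t) ^ p j * (d * suc t) ^ q j                      ≡⟨ cong₂ (λ a b → a ^ p j * b ^ q j) (X.at j) (sym (X.at j)) ⟩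
        (d * suc t) ^ p j * (u * t) ^ q j                      ≡⟨ cong₂ _*_ (^-distribʳ-* (p j) d (suc t)) (^-distribʳ-* (q j) u t) ⟩
        (d ^ p j * suc t ^ p j) * (u ^ q j * t ^ q j)          ≡⟨ regroup′ (d ^ p j) (suc t ^ p j) (u ^ q j) (t ^ q j) ⟩
        u ^ q j * d ^ p j * (suc t ^ p j * t ^ q j)            ≡⟨ cong (_* (suc t ^ p j * t ^ q j)) (homs-factor q p j j) ⟨
        homs (factor q p j) j * (suc t ^ p j * t ^ q j)        ∎

-- Integer linear algebra

∑ℤ-linear : ∀ {n} a b (f g : Fin n → ℤ) →
  ∑ℤ (λ i → a ℤ.* f i ℤ.+ b ℤ.* g i) ≡ a ℤ.* ∑ℤ f ℤ.+ b ℤ.* ∑ℤ g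
∑ℤ-linear a b f g = trans (∑ℤ-distrib-+ (λ i → a ℤ.* f i) (λ i → b ℤ.* g i))
  (sym (cong₂ ℤ._+_ (*-distribˡ-∑ℤ a f) (*-distribˡ-∑ℤ b g)))

∑ℤ-zero : ∀ {n} (f : Fin n → ℤ) → (∀ i → f i ≡ 0ℤ) → ∑ℤ f ≡ 0ℤ
∑ℤ-zero {n} f f≡0 = trans (∑ℤ-cong {n} f≡0) (∑ℤ-0 n)

infixl 7 _∙_
_∙_ : ∀ {n} → (Fin n → ℤ) → (Fin n → ℤ) → ℤ
z ∙ v = ∑ℤ (λ i → z i ℤ.* v i)

-- Membership of k in the rational span of the S j, with denominators cleared. J may be infinite,
-- but only finitely many members enter.
record IntegerRelation {n} {J : Set ℓ} (S : J → Fin n → ℤ) (k : Fin n → ℤ) : Set ℓ where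
  field
    scale    : ℕ
    scale-pos : 0 < scale
    size     : ℕ
    coeff    : Fin size → ℤ
    index    : Fin size → J
    relation : ∀ i → + scale ℤ.* k i ≡ ∑ℤ (λ a → coeff a ℤ.* S (index a) i)

record Separator {n} {J : Set ℓ} (S : J → Fin n → ℤ) (k : Fin n → ℤ) : Set ℓ where
  field
    z          : Fin n → ℤ
    orthogonal : ∀ j → z ∙ S j ≡ 0ℤ
    separates  : z ∙ k ≢ 0ℤ

private
  ∣i∣*∣i∣≡i*i : ∀ i → + (∣ i ∣ * ∣ i ∣) ≡ i ℤ.* i
  ∣i∣*∣i∣≡i*i (+ zero)  = refl
  ∣i∣*∣i∣≡i*i (+ suc n) = refl
  ∣i∣*∣i∣≡i*i -[1+ n ]  = refl

  0<∣i∣ : ∀ {i} → i ≢ 0ℤ → 0 < ∣ i ∣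
  0<∣i∣ {+ zero}   i≢0 = contradiction refl i≢0
  0<∣i∣ {+ suc n}  i≢0 = s≤s z≤n
  0<∣i∣ { -[1+ n ]} i≢0 = s≤s z≤n

module _ {n} {J : Set ℓ} (S : J → Fin (suc n) → ℤ) (k : Fin (suc n) → ℤ) where

  -- Fraction-free elimination of coordinate zero with pivot s.
  module Pivot (j₀ : J) (s₀≢0 : S j₀ zero ≢ 0ℤ) where

    private
      s  = S j₀
      s₀ = s zero

    -- The remaining coordinates of s₀ · v - v₀ · s, whose coordinate zero vanishes.
    eliminate : (Fin (suc n) → ℤ) → Fin n → ℤ
    eliminate v i = s₀ ℤ.* v (suc i) ℤ.+ ℤ.- v zero ℤ.* s (suc i)

    lift-relation : IntegerRelation (eliminate ∘ S) (eliminate k) → IntegerRelation S k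
    lift-relation rel = record
      -- The relation for the eliminated vectors is multiplied by s₀. Then k has the factor s₀² ·
      -- scale, positive whatever the sign of s₀, and d collects the additional multiples of the
      -- pivot row.
      { scale = scale * (∣ s₀ ∣ * ∣ s₀ ∣)
      ; scale-pos = *-mono-≤ scale-pos (*-mono-≤ (0<∣i∣ s₀≢0) (0<∣i∣ s₀≢0))
      ; size = suc size
      ; coeff = λ { zero → d ; (suc a) → s₀ ℤ.* s₀ ℤ.* coeff a }
      ; index = λ { zero → j₀ ; (suc a) → index a }
      ; relation = λ i → trans (cong (ℤ._* k i) scale≡) (trans (by i) (cong (λ x → d ℤ.* s i ℤ.+ x) (sym (scaled i))))
      }
      where
      open IntegerRelation rel
      open ≡-Reasoning
      A : Fin (suc n) → ℤ
      A i = ∑ℤ (λ a → coeff a ℤ.* S (index a) i)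
      d = s₀ ℤ.* (+ scale ℤ.* k zero ℤ.- A zero)
      scale≡ : + (scale * (∣ s₀ ∣ * ∣ s₀ ∣)) ≡ + scale ℤ.* (s₀ ℤ.* s₀)
      scale≡ = trans (ℤₚ.pos-* scale (∣ s₀ ∣ * ∣ s₀ ∣)) (cong (+ scale ℤ.*_) (∣i∣*∣i∣≡i*i s₀))
      scaled : ∀ i → ∑ℤ (λ a → s₀ ℤ.* s₀ ℤ.* coeff a ℤ.* S (index a) i) ≡ s₀ ℤ.* s₀ ℤ.* A i
      scaled i = trans (∑ℤ-cong {size} λ a → ℤₚ.*-assoc (s₀ ℤ.* s₀) (coeff a) (S (index a) i))
        (sym (*-distribˡ-∑ℤ (s₀ ℤ.* s₀) (λ a → coeff a ℤ.* S (index a) i)))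
      eliminated : ∀ i → + scale ℤ.* eliminate k i ≡ s₀ ℤ.* A (suc i) ℤ.+ ℤ.- s (suc i) ℤ.* A zero
      eliminated i = begin
        + scale ℤ.* eliminate k i
          ≡⟨ relation i ⟩
        ∑ℤ (λ a → coeff a ℤ.* eliminate (S (index a)) i)
          ≡⟨ ∑ℤ-cong {size} (λ a → rearrange (coeff a) s₀ (S (index a) (suc i)) (S (index a) zero) (s (suc i))) ⟩
        ∑ℤ (λ a → s₀ ℤ.* (coeff a ℤ.* S (index a) (suc i)) ℤ.+ ℤ.- s (suc i) ℤ.* (coeff a ℤ.* S (index a) zero))
          ≡⟨ ∑ℤ-linear s₀ (ℤ.- s (suc i)) (λ a → coeff a ℤ.* S (index a) (suc i)) (λ a → coeff a ℤ.* S (index a) zero) ⟩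
        s₀ ℤ.* A (suc i) ℤ.+ ℤ.- s (suc i) ℤ.* A zero
          ∎
        where
        rearrange : ∀ c p x y q → c ℤ.* (p ℤ.* x ℤ.+ ℤ.- y ℤ.* q) ≡ p ℤ.* (c ℤ.* x) ℤ.+ ℤ.- q ℤ.* (c ℤ.* y)
        rearrange = ℤ-Solver.solve-∀
      by : ∀ i → + scale ℤ.* (s₀ ℤ.* s₀) ℤ.* k i ≡ d ℤ.* s i ℤ.+ s₀ ℤ.* s₀ ℤ.* A i
      by zero = lemma (+ scale) s₀ (k zero) (A zero)
        where
        lemma : ∀ N p x a → N ℤ.* (p ℤ.* p) ℤ.* x ≡ p ℤ.* (N ℤ.* x ℤ.- a) ℤ.* p ℤ.+ p ℤ.* p ℤ.* a
        lemma = ℤ-Solver.solve-∀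
      by (suc i) = begin
        N ℤ.* (s₀ ℤ.* s₀) ℤ.* k (suc i)
          ≡⟨ before N s₀ (k (suc i)) (k zero) (s (suc i)) ⟩
        s₀ ℤ.* (N ℤ.* eliminate k i) ℤ.+ s₀ ℤ.* N ℤ.* k zero ℤ.* s (suc i)
          ≡⟨ cong (λ x → s₀ ℤ.* x ℤ.+ s₀ ℤ.* N ℤ.* k zero ℤ.* s (suc i)) (eliminated i) ⟩
        s₀ ℤ.* (s₀ ℤ.* A (suc i) ℤ.+ ℤ.- s (suc i) ℤ.* A zero) ℤ.+ s₀ ℤ.* N ℤ.* k zero ℤ.* s (suc i)
          ≡⟨ after N s₀ (A (suc i)) (s (suc i)) (A zero) (k zero) ⟩
        d ℤ.* s (suc i) ℤ.+ s₀ ℤ.* s₀ ℤ.* A (suc i)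
          ∎
        where
        N = + scale
        before : ∀ N p x y q → N ℤ.* (p ℤ.* p) ℤ.* x ≡ p ℤ.* (N ℤ.* (p ℤ.* x ℤ.+ ℤ.- y ℤ.* q)) ℤ.+ p ℤ.* N ℤ.* y ℤ.* q
        before = ℤ-Solver.solve-∀
        after : ∀ N p a q b y → p ℤ.* (p ℤ.* a ℤ.+ ℤ.- q ℤ.* b) ℤ.+ p ℤ.* N ℤ.* y ℤ.* q
          ≡ p ℤ.* (N ℤ.* y ℤ.- b) ℤ.* q ℤ.+ p ℤ.* p ℤ.* a
        after = ℤ-Solver.solve-∀

    -- The new vector is the image of z under the transpose of `eliminate`, whence its product with
    -- v is z ∙ eliminate v.
    lift-separator : Separator (eliminate ∘ S) (eliminate k) → Separator S k
    lift-separator sep = record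
      { z = z⁺
      ; orthogonal = λ j → trans (z⁺∙ (S j)) (orthogonal j)
      ; separates = λ eq → separates (trans (sym (z⁺∙ k)) eq)
      }
      where
      open Separator sep
      open ≡-Reasoning
      z∙s = z ∙ (s ∘ suc)
      z⁺ : Fin (suc n) → ℤ
      z⁺ zero    = ℤ.- z∙s
      z⁺ (suc i) = s₀ ℤ.* z i
      z⁺∙ : ∀ v → z⁺ ∙ v ≡ z ∙ eliminate v
      z⁺∙ v = begin
        ℤ.- z∙s ℤ.* v zero ℤ.+ ∑ℤ (λ i → s₀ ℤ.* z i ℤ.* v (suc i))
          ≡⟨ cong (λ x → ℤ.- z∙s ℤ.* v zero ℤ.+ x) (∑ℤ-cong {n} λ i → ℤₚ.*-assoc s₀ (z i) (v (suc i))) ⟩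
        ℤ.- z∙s ℤ.* v zero ℤ.+ ∑ℤ (λ i → s₀ ℤ.* (z i ℤ.* v (suc i)))
          ≡⟨ cong (λ x → ℤ.- z∙s ℤ.* v zero ℤ.+ x) (*-distribˡ-∑ℤ s₀ (λ i → z i ℤ.* v (suc i))) ⟨
        ℤ.- z∙s ℤ.* v zero ℤ.+ s₀ ℤ.* (z ∙ (v ∘ suc))
          ≡⟨ swap z∙s (v zero) (s₀ ℤ.* (z ∙ (v ∘ suc))) ⟩
        s₀ ℤ.* (z ∙ (v ∘ suc)) ℤ.+ ℤ.- v zero ℤ.* z∙s
          ≡⟨ ∑ℤ-linear s₀ (ℤ.- v zero) (λ i → z i ℤ.* v (suc i)) (λ i → z i ℤ.* s (suc i)) ⟨
        ∑ℤ (λ i → s₀ ℤ.* (z i ℤ.* v (suc i)) ℤ.+ ℤ.- v zero ℤ.* (z i ℤ.* s (suc i)))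
          ≡⟨ ∑ℤ-cong {n} (λ i → rearrange s₀ (z i) (v (suc i)) (v zero) (s (suc i))) ⟩
        z ∙ eliminate v
          ∎
        where
        swap : ∀ a b c → ℤ.- a ℤ.* b ℤ.+ c ≡ c ℤ.+ ℤ.- b ℤ.* a
        swap = ℤ-Solver.solve-∀
        rearrange : ∀ p z x y q → p ℤ.* (z ℤ.* x) ℤ.+ ℤ.- y ℤ.* (z ℤ.* q) ≡ z ℤ.* (p ℤ.* x ℤ.+ ℤ.- y ℤ.* q)
        rearrange = ℤ-Solver.solve-∀

  module NoPivot (S₀≡0 : ∀ j → S j zero ≡ 0ℤ) where

    lift-relation : k zero ≡ 0ℤ → IntegerRelation (λ j → S j ∘ suc) (k ∘ suc) → IntegerRelation S k
    lift-relation k₀≡0 rel = record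
      { scale = scale
      ; scale-pos = scale-pos
      ; size = size
      ; coeff = coeff
      ; index = index
      ; relation = λ
        { zero → trans (trans (cong (+ scale ℤ.*_) k₀≡0) (ℤₚ.*-zeroʳ (+ scale)))
            (sym (∑ℤ-zero _ λ a → trans (cong (coeff a ℤ.*_) (S₀≡0 (index a))) (ℤₚ.*-zeroʳ (coeff a))))
        ; (suc i) → relation i
        }
      }
      where open IntegerRelation rel

    lift-separator : Separator (λ j → S j ∘ suc) (k ∘ suc) → Separator S k
    lift-separator sep = record
      { z = λ { zero → 0ℤ ; (suc i) → z i }
      ; orthogonal = λ j → trans (ℤₚ.+-identityˡ _) (orthogonal j)
      ; separates = λ eq → separates (trans (sym (ℤₚ.+-identityˡ _)) eq)
      }
      where open Separator sep

    coordinate-separator : k zero ≢ 0ℤ → Separator S k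
    coordinate-separator k₀≢0 = record
      { z = e₀
      ; orthogonal = λ j → trans (e₀∙ (S j)) (S₀≡0 j)
      ; separates = λ eq → k₀≢0 (trans (sym (e₀∙ k)) eq)
      }
      where
      e₀ : Fin (suc n) → ℤ
      e₀ zero    = 1ℤ
      e₀ (suc i) = 0ℤ
      e₀∙ : ∀ v → e₀ ∙ v ≡ v zero
      e₀∙ v = trans (cong₂ ℤ._+_ (ℤₚ.*-identityˡ (v zero)) (∑ℤ-zero {n} _ λ i → ℤₚ.*-zeroˡ (v (suc i)))) (ℤₚ.+-identityʳ (v zero))

-- The induction is on the number of coordinates, since the family J may be infinite; excluded
-- middle decides whether some row can serve as pivot.
relation-or-separator : ExcludedMiddle ℓ → ∀ {n} {J : Set ℓ} (S : J → Fin n → ℤ) (k : Fin n → ℤ) →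
  IntegerRelation S k ⊎ Separator S k
relation-or-separator em {zero} S k = inj₁ (record
  { scale = 1 ; scale-pos = s≤s z≤n ; size = 0 ; coeff = λ () ; index = λ () ; relation = λ () })
relation-or-separator em {suc n} {J} S k with em {∃ λ j → S j zero ≢ 0ℤ}
... | yes (j₀ , s₀≢0) with relation-or-separator em (Pivot.eliminate S k j₀ s₀≢0 ∘ S) (Pivot.eliminate S k j₀ s₀≢0 k)
...   | inj₁ rel = inj₁ (Pivot.lift-relation S k j₀ s₀≢0 rel)
...   | inj₂ sep = inj₂ (Pivot.lift-separator S k j₀ s₀≢0 sep)
relation-or-separator em {suc n} {J} S k | no ∄j = by (k zero ℤ.≟ 0ℤ)
  where
  S₀≡0 : ∀ j → S j zero ≡ 0ℤ
  S₀≡0 j = decidable-stable (S j zero ℤ.≟ 0ℤ) λ ≢0 → ∄j (j , ≢0)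
  by : Dec (k zero ≡ 0ℤ) → IntegerRelation S k ⊎ Separator S k
  by (no k₀≢0) = inj₂ (NoPivot.coordinate-separator S k S₀≡0 k₀≢0)
  by (yes k₀≡0) with relation-or-separator em (λ j → S j ∘ suc) (k ∘ suc)
  ... | inj₁ rel = inj₁ (NoPivot.lift-relation S k S₀≡0 k₀≡0 rel)
  ... | inj₂ sep = inj₂ (NoPivot.lift-separator S k S₀≡0 sep)

-- Monomials in homomorphism counts

^-pos : ∀ {a} n → 0 < a → 0 < a ^ n
^-pos {suc a} n _ = m^n>0 (suc a) n

^-injectiveˡ : ∀ n {a b} → 0 < n → a ^ n ≡ b ^ n → a ≡ b
^-injectiveˡ (suc n) {a} {b} _ eq with <-cmp a b
... | tri< a<b _ _ = contradiction eq (<⇒≢ (^-monoˡ-< (suc n) a<b))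
... | tri≈ _ a≡b _ = a≡b
... | tri> _ _ b<a = contradiction (sym eq) (<⇒≢ (^-monoˡ-< (suc n) b<a))

^-∏ : ∀ k {n} (f : Fin n → ℕ) → ∏ f ^ k ≡ ∏ (λ i → f i ^ k)
^-∏ k {zero}  f = ^-zeroˡ k
^-∏ k {suc n} f = trans (^-distribʳ-* k (f zero) (∏ (f ∘ suc))) (cong (f zero ^ k *_) (^-∏ k (f ∘ suc)))

^-∑ : ∀ a {n} (k : Fin n → ℕ) → ∏ (λ i → a ^ k i) ≡ a ^ ∑ℕ k
^-∑ a {zero}  k = refl
^-∑ a {suc n} k = trans (cong (a ^ k zero *_) (^-∑ a (k ∘ suc))) (sym (^-distribˡ-+-* a (k zero) (∑ℕ (k ∘ suc))))

infixl 7 _∙ℕ_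
_∙ℕ_ : ∀ {n} → (Fin n → ℕ) → (Fin n → ℕ) → ℕ
p ∙ℕ m = ∑ℕ (λ i → p i * m i)

monomial : ∀ {n} → (Fin n → ℕ) → (Fin n → ℕ) → ℕ
monomial x m = ∏ (λ i → x i ^ m i)

monomial-+ : ∀ {n} (x m m′ : Fin n → ℕ) → monomial x (λ i → m i + m′ i) ≡ monomial x m * monomial x m′
monomial-+ {n} x m m′ = trans (∏-cong {n} λ i → ^-distribˡ-+-* (x i) (m i) (m′ i))
  (∏-distrib-* (λ i → x i ^ m i) (λ i → x i ^ m′ i))

monomial-* : ∀ {n} (x m : Fin n → ℕ) k → monomial x (λ i → k * m i) ≡ monomial x m ^ k
monomial-* {n} x m k = trans (∏-cong {n} λ i → trans (cong (x i ^_) (*-comm k (m i))) (sym (^-*-assoc (x i) (m i) k)))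
  (sym (^-∏ k (λ i → x i ^ m i)))

monomial-∑ : ∀ {n r} (x : Fin n → ℕ) (c : Fin r → ℕ) (m : Fin r → Fin n → ℕ) →
  monomial x (λ i → ∑ℕ (λ a → c a * m a i)) ≡ monomial (λ a → monomial x (m a)) c
monomial-∑ {n} {r} x c m = begin
  ∏ (λ i → x i ^ ∑ℕ (λ a → c a * m a i))           ≡⟨ ∏-cong {n} (λ i → ^-∑ (x i) (λ a → c a * m a i)) ⟨
  ∏ (λ i → ∏ (λ a → x i ^ (c a * m a i)))          ≡⟨ ∏-comm (λ i a → x i ^ (c a * m a i)) ⟩
  ∏ (λ a → ∏ (λ i → x i ^ (c a * m a i)))          ≡⟨ ∏-cong {r} (λ a → monomial-* x (m a) (c a)) ⟩
  ∏ (λ a → ∏ (λ i → x i ^ m a i) ^ c a)            ∎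
  where open ≡-Reasoning

monomial-cong : ∀ {n} {x y m k : Fin n → ℕ} → x ≗ y → m ≗ k → monomial x m ≡ monomial y k
monomial-cong {n} x≗y m≗k = ∏-cong {n} λ i → cong₂ _^_ (x≗y i) (m≗k i)

-- All coordinates share the base s / t, so their ratios (s / t) ^ (pᵢ - qᵢ) combine to a single
-- power with exponent p ∙ m - q ∙ m.
monomial-ratio : ∀ {n} {x y : Fin n → ℕ} {s t} (p q : Fin n → ℕ) →
  (∀ i → x i * (t ^ p i * s ^ q i) ≡ y i * (s ^ p i * t ^ q i)) →
  ∀ m → monomial x m * (t ^ (p ∙ℕ m) * s ^ (q ∙ℕ m)) ≡ monomial y m * (s ^ (p ∙ℕ m) * t ^ (q ∙ℕ m))
monomial-ratio {n} {x} {y} {s} {t} p q eq m = trans (sym (expand x t s))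
  (trans (∏-cong {n} λ i → cong (_^ m i) (eq i)) (expand y s t))
  where
  open ≡-Reasoning
  power : ∀ a (p : Fin n → ℕ) → ∏ (λ i → (a ^ p i) ^ m i) ≡ a ^ (p ∙ℕ m)
  power a p = trans (∏-cong {n} λ i → ^-*-assoc a (p i) (m i)) (^-∑ a (λ i → p i * m i))
  expand : ∀ (x : Fin n → ℕ) t s →
    ∏ (λ i → (x i * (t ^ p i * s ^ q i)) ^ m i) ≡ monomial x m * (t ^ (p ∙ℕ m) * s ^ (q ∙ℕ m))
  expand x t s = begin
    ∏ (λ i → (x i * (t ^ p i * s ^ q i)) ^ m i)
      ≡⟨ ∏-cong {n} (λ i → trans (^-distribʳ-* (m i) (x i) (t ^ p i * s ^ q i))
           (cong (x i ^ m i *_) (^-distribʳ-* (m i) (t ^ p i) (s ^ q i)))) ⟩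
    ∏ (λ i → x i ^ m i * ((t ^ p i) ^ m i * (s ^ q i) ^ m i))
      ≡⟨ ∏-distrib-* (λ i → x i ^ m i) (λ i → (t ^ p i) ^ m i * (s ^ q i) ^ m i) ⟩
    monomial x m * ∏ (λ i → (t ^ p i) ^ m i * (s ^ q i) ^ m i)
      ≡⟨ cong (monomial x m *_) (∏-distrib-* (λ i → (t ^ p i) ^ m i) (λ i → (s ^ q i) ^ m i)) ⟩
    monomial x m * (∏ (λ i → (t ^ p i) ^ m i) * ∏ (λ i → (s ^ q i) ^ m i))
      ≡⟨ cong (monomial x m *_) (cong₂ _*_ (power t p) (power s q)) ⟩
    monomial x m * (t ^ (p ∙ℕ m) * s ^ (q ∙ℕ m))
      ∎

ratio-equal : ∀ {X Y} t {a b} → a ≡ b →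
  X * (suc t ^ a * suc (suc t) ^ b) ≡ Y * (suc (suc t) ^ a * suc t ^ b) → X ≡ Y
ratio-equal {X} {Y} t {a} refl eq = *-cancelʳ-≡ X Y (suc t ^ a * suc (suc t) ^ a)
  {{m*n≢0 (suc t ^ a) (suc (suc t) ^ a) {{m^n≢0 (suc t) a}} {{m^n≢0 (suc (suc t)) a}}}}
  (trans eq (cong (Y *_) (*-comm (suc (suc t) ^ a) (suc t ^ a))))

-- If b = a + e + 1, cancelling u ^ a * v ^ a leaves u ^ (e + 1) = v ^ (e + 1), although u < v; the
-- case b < a is symmetric.
crossed-powers : ∀ t a b → suc t ^ a * suc (suc t) ^ b ≡ suc (suc t) ^ a * suc t ^ b → a ≡ b
crossed-powers t a b eq = by (<-cmp a b)
  where
  u = suc t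
  v = suc (suc t)
  impossible : ∀ {a b} → a < b → u ^ a * v ^ b ≢ v ^ a * u ^ b
  impossible {a} {b} a<b eq with e , refl ← m≤n⇒∃[o]m+o≡n a<b = <⇒≢ (^-monoˡ-< (suc e) (n<1+n u))
    (*-cancelˡ-≡ (u ^ suc e) (v ^ suc e) (u ^ a * v ^ a)
      {{m*n≢0 (u ^ a) (v ^ a) {{m^n≢0 u a}} {{m^n≢0 v a}}}}
      (trans (sym (split′ u)) (trans (sym eq) (split v))))
    where
    exponent : ∀ w → w ^ (suc a + e) ≡ w ^ a * w ^ suc e
    exponent w = trans (cong (w ^_) (sym (+-suc a e))) (^-distribˡ-+-* w a (suc e))
    assoc : ∀ x y z → x * (y * z) ≡ x * y * z
    assoc = ℕ-Solver.solve-∀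
    swap : ∀ x y z → x * (y * z) ≡ y * x * z
    swap = ℕ-Solver.solve-∀
    split : ∀ w → u ^ a * w ^ (suc a + e) ≡ u ^ a * w ^ a * w ^ suc e
    split w = trans (cong (u ^ a *_) (exponent w)) (assoc (u ^ a) (w ^ a) (w ^ suc e))
    split′ : ∀ w → v ^ a * w ^ (suc a + e) ≡ w ^ a * v ^ a * w ^ suc e
    split′ w = trans (cong (v ^ a *_) (exponent w)) (swap (v ^ a) (w ^ a) (w ^ suc e))
  by : _ → a ≡ b
  by (tri< a<b _ _) = contradiction eq (impossible a<b)
  by (tri≈ _ a≡b _) = a≡b
  by (tri> _ _ b<a) = contradiction
    (trans (*-comm (u ^ b) (v ^ a)) (trans (sym eq) (*-comm (u ^ a) (v ^ b)))) (impossible b<a)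

ratio-differs : ∀ {X} t {a b} → 0 < X →
  X * (suc t ^ a * suc (suc t) ^ b) ≡ X * (suc (suc t) ^ a * suc t ^ b) → a ≡ b
ratio-differs {X} t {a} {b} X>0 eq = crossed-powers t a b (*-cancelˡ-≡ _ _ X {{>-nonZero X>0}} eq)

-- Integer exponents and consequences of an integer relation

_⁺ _⁻ : ℤ → ℕ
(+ n) ⁺ = n
-[1+ n ] ⁺ = 0
(+ n) ⁻ = 0
-[1+ n ] ⁻ = suc n

⁺-⁻ : ∀ i → i ≡ + (i ⁺) ℤ.- + (i ⁻)
⁺-⁻ (+ n)    = sym (ℤₚ.+-identityʳ (+ n))
⁺-⁻ -[1+ n ] = sym (ℤₚ.+-identityˡ -[1+ n ])

∙-parts : ∀ {n} (z : Fin n → ℤ) (m : Fin n → ℕ) →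
  z ∙ (+_ ∘ m) ≡ + ((_⁺ ∘ z) ∙ℕ m) ℤ.- + ((_⁻ ∘ z) ∙ℕ m)
∙-parts {zero}  z m = refl
∙-parts {suc n} z m = begin
  z zero ℤ.* + m zero ℤ.+ (z ∘ suc) ∙ (+_ ∘ m ∘ suc)
    ≡⟨ cong₂ (λ a b → a ℤ.* + m zero ℤ.+ b) (⁺-⁻ (z zero)) (∙-parts (z ∘ suc) (m ∘ suc)) ⟩
  (+ (z zero ⁺) ℤ.- + (z zero ⁻)) ℤ.* + m zero ℤ.+ (+ P ℤ.- + Q)
    ≡⟨ rearrange (+ (z zero ⁺)) (+ (z zero ⁻)) (+ m zero) (+ P) (+ Q) ⟩
  (+ (z zero ⁺) ℤ.* + m zero ℤ.+ + P) ℤ.- (+ (z zero ⁻) ℤ.* + m zero ℤ.+ + Q)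
    ≡⟨ cong₂ ℤ._-_ (embed (z zero ⁺) P) (embed (z zero ⁻) Q) ⟨
  + (z zero ⁺ * m zero + P) ℤ.- + (z zero ⁻ * m zero + Q)
    ∎
  where
  open ≡-Reasoning
  P = (_⁺ ∘ z ∘ suc) ∙ℕ (m ∘ suc)
  Q = (_⁻ ∘ z ∘ suc) ∙ℕ (m ∘ suc)
  rearrange : ∀ a b m p q → (a ℤ.- b) ℤ.* m ℤ.+ (p ℤ.- q) ≡ (a ℤ.* m ℤ.+ p) ℤ.- (b ℤ.* m ℤ.+ q)
  rearrange = ℤ-Solver.solve-∀
  embed : ∀ a P → + (a * m zero + P) ≡ + a ℤ.* + m zero ℤ.+ + P
  embed a P = trans (ℤₚ.pos-+ (a * m zero) P) (cong (ℤ._+ + P) (ℤₚ.pos-* a (m zero)))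

module _ {n} {J : Set ℓ} {S : J → Fin n → ℕ} {k : Fin n → ℕ}
  (rel : IntegerRelation (λ j → +_ ∘ S j) (+_ ∘ k)) where
  open IntegerRelation rel
  open ≡-Reasoning

  private
    c⁺ c⁻ : Fin size → ℕ
    c⁺ = _⁺ ∘ coeff
    c⁻ = _⁻ ∘ coeff
    rows : Fin size → Fin n → ℕ
    rows a = S (index a)

    -- Negative coefficients move to the other side, so that both sides can serve as exponents.
    ℕ-relation : ∀ i → scale * k i + c⁻ ∙ℕ (λ a → rows a i) ≡ c⁺ ∙ℕ (λ a → rows a i)
    ℕ-relation i = ℤₚ.+-injective (begin
      + (scale * k i + Q)                ≡⟨ ℤₚ.pos-+ (scale * k i) Q ⟩
      + (scale * k i) ℤ.+ + Q            ≡⟨ cong (ℤ._+ + Q) (ℤₚ.pos-* scale (k i)) ⟩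
      + scale ℤ.* + k i ℤ.+ + Q          ≡⟨ cong (ℤ._+ + Q) (relation i) ⟩
      coeff ∙ (λ a → + rows a i) ℤ.+ + Q ≡⟨ cong (ℤ._+ + Q) (∙-parts coeff (λ a → rows a i)) ⟩
      (+ P ℤ.- + Q) ℤ.+ + Q              ≡⟨ cancel (+ P) (+ Q) ⟩
      + P                                ∎)
      where
      P = c⁺ ∙ℕ (λ a → rows a i)
      Q = c⁻ ∙ℕ (λ a → rows a i)
      cancel : ∀ p q → (p ℤ.- q) ℤ.+ q ≡ p
      cancel = ℤ-Solver.solve-∀

    monomial-relation : ∀ x → monomial x k ^ scale * monomial (λ a → monomial x (rows a)) c⁻
      ≡ monomial (λ a → monomial x (rows a)) c⁺
    monomial-relation x = begin
      monomial x k ^ scale * monomial (λ a → monomial x (rows a)) c⁻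
        ≡⟨ cong₂ _*_ (monomial-* x k scale) (monomial-∑ x c⁻ rows) ⟨
      monomial x (λ i → scale * k i) * monomial x (λ i → c⁻ ∙ℕ (λ a → rows a i))
        ≡⟨ monomial-+ x (λ i → scale * k i) (λ i → c⁻ ∙ℕ (λ a → rows a i)) ⟨
      monomial x (λ i → scale * k i + c⁻ ∙ℕ (λ a → rows a i))
        ≡⟨ monomial-cong {x = x} (λ _ → refl) ℕ-relation ⟩
      monomial x (λ i → c⁺ ∙ℕ (λ a → rows a i))
        ≡⟨ monomial-∑ x c⁺ rows ⟩
      monomial (λ a → monomial x (rows a)) c⁺
        ∎

  -- If yᵢ = 0, the positive monomials of the rows have exponent 0 at i; by the relation so has that
  -- of k, and 0 ^ 0 = 1.
  relation-pos : ∀ y → (∀ a → 0 < monomial y (S (index a))) → 0 < monomial y k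
  relation-pos y pos = ∏-pos (λ i → y i ^ k i) factor-pos
    where
    factor-pos : ∀ i → 0 < y i ^ k i
    factor-pos i with y i in yi
    ... | suc b = m^n>0 (suc b) (k i)
    ... | zero  = subst (λ e → 0 < 0 ^ e) (sym ki≡0) (s≤s z≤n)
      where
      zero-exponent : ∀ {n} (y m : Fin n → ℕ) i → y i ≡ 0 → 0 < monomial y m → m i ≡ 0
      zero-exponent y m zero y≡0 pos with m zero
      ... | zero  = refl
      ... | suc e rewrite y≡0 with pos
      ...   | ()
      zero-exponent y m (suc i) y≡0 pos with monomial (y ∘ suc) (m ∘ suc) in eq
      ... | suc r = zero-exponent (y ∘ suc) (m ∘ suc) i y≡0 (subst (0 <_) (sym eq) (s≤s z≤n))
      ... | zero with () ← subst (0 <_) (*-zeroʳ (y zero ^ m zero)) pos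
      ki≡0 : k i ≡ 0
      ki≡0 = [ (λ scale≡0 → contradiction (sym scale≡0) (<⇒≢ scale-pos)) , id ]′ (m*n≡0⇒m≡0∨n≡0 scale
        (ℤₚ.+-injective (trans (ℤₚ.pos-* scale (k i)) (trans (relation i)
          (∑ℤ-zero _ λ a → trans
            (cong (λ e → coeff a ℤ.* + e) (zero-exponent y (rows a) i yi (pos a))) (ℤₚ.*-zeroʳ (coeff a)))))))

  -- With X the monomial of k, the relation reads X ^ scale * W⁻ = W⁺, where W⁻ and W⁺ depend only
  -- on the monomials of the rows. As W⁻ and `scale` are positive, this determines X.
  relation-equal : ∀ x y → (∀ a → monomial x (S (index a)) ≡ monomial y (S (index a))) →
    (∀ a → 0 < monomial y (S (index a))) → monomial x k ≡ monomial y k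
  relation-equal x y eq pos = ^-injectiveˡ scale scale-pos
    (*-cancelʳ-≡ (monomial x k ^ scale) (monomial y k ^ scale) (monomial w c⁻)
      {{>-nonZero (∏-pos (λ a → w a ^ c⁻ a) λ a → ^-pos (c⁻ a) (pos a))}} (begin
        monomial x k ^ scale * monomial w c⁻    ≡⟨ cong (monomial x k ^ scale *_) (monomial-cong {m = c⁻} eq (λ _ → refl)) ⟨
        monomial x k ^ scale * monomial w′ c⁻   ≡⟨ monomial-relation x ⟩
        monomial w′ c⁺                          ≡⟨ monomial-cong {m = c⁺} eq (λ _ → refl) ⟩
        monomial w c⁺                           ≡⟨ monomial-relation y ⟨
        monomial y k ^ scale * monomial w c⁻    ∎))
    where
    w w′ : Fin size → ℕ
    w a = monomial y (rows a)
    w′ a = monomial x (rows a)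

-- Rational relations and real spans

module _ {c ℓ} (R : CommutativeRing c ℓ) where

  private module R = CommutativeRing R
  open import Algebra.Properties.Monoid.Sum R.+-monoid using (sum)
  open import Algebra.Properties.Semiring.Sum R.semiring hiding (sum)

  module IntegerScalars (ι : ℤ → R.Carrier) (ι-0 : ι 0ℤ R.≈ R.0#)
    (ι-+ : ∀ a b → ι (a ℤ.+ b) R.≈ ι a R.+ ι b) (ι-* : ∀ a b → ι (a ℤ.* b) R.≈ ι a R.* ι b) where

    open SetoidReasoning R.setoid

    ι-∑ : ∀ {n} (f : Fin n → ℤ) → ι (∑ℤ f) R.≈ sum (ι ∘ f)
    ι-∑ {zero}  f = ι-0
    ι-∑ {suc n} f = R.trans (ι-+ (f zero) (∑ℤ (f ∘ suc))) (R.+-congˡ (ι-∑ (f ∘ suc)))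

    ι-∙ : ∀ {n} (z v : Fin n → ℤ) → ι (z ∙ v) R.≈ sum (λ i → ι (z i) R.* ι (v i))
    ι-∙ {n} z v = R.trans (ι-∑ (λ i → z i ℤ.* v i)) (sum-cong-≋ {n} λ i → ι-* (z i) (v i))

    -- Exchanging the sums pairs z with the rows, so integer orthogonality survives coefficients
    -- from any commutative ring. `f` holds the summands in the form in which a span provides them.
    combination-orthogonal : ∀ {m n} (a : Fin m → R.Carrier) (S : Fin m → Fin n → ℤ) (k : Fin n → ℤ) →
      (f : Fin n → Fin m → R.Carrier) → (∀ i l → f i l R.≈ a l R.* ι (S l i)) → (∀ i → ι (k i) R.≈ sum (f i)) →
      ∀ z → (∀ l → z ∙ S l ≡ 0ℤ) → ι (z ∙ k) R.≈ R.0#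
    combination-orthogonal {m} {n} a S k f f≈ k≈ z z⊥S = begin
      ι (z ∙ k)
        ≈⟨ ι-∙ z k ⟩
      sum (λ i → ι (z i) R.* ι (k i))
        ≈⟨ sum-cong-≋ {n} (λ i → R.*-congˡ (R.trans (k≈ i) (sum-cong-≋ {m} (f≈ i)))) ⟩
      sum (λ i → ι (z i) R.* sum (λ l → a l R.* ι (S l i)))
        ≈⟨ sum-cong-≋ {n} (λ i → *-distribˡ-sum (ι (z i)) (λ l → a l R.* ι (S l i))) ⟩
      sum (λ i → sum (λ l → ι (z i) R.* (a l R.* ι (S l i))))
        ≈⟨ ∑-comm (λ i l → ι (z i) R.* (a l R.* ι (S l i))) ⟩
      sum (λ l → sum (λ i → ι (z i) R.* (a l R.* ι (S l i))))
        ≈⟨ sum-cong-≋ {m} (λ l → vanish l) ⟩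
      sum {m} (λ _ → R.0#)
        ≈⟨ sum-replicate-zero m ⟩
      R.0#
        ∎
      where
      swap : ∀ x y w → x R.* (y R.* w) R.≈ y R.* (x R.* w)
      swap x y w = R.trans (R.sym (R.*-assoc x y w)) (R.trans (R.*-congʳ (R.*-comm x y)) (R.*-assoc y x w))
      vanish : ∀ l → sum (λ i → ι (z i) R.* (a l R.* ι (S l i))) R.≈ R.0#
      vanish l = begin
        sum (λ i → ι (z i) R.* (a l R.* ι (S l i)))   ≈⟨ sum-cong-≋ {n} (λ i → swap (ι (z i)) (a l) (ι (S l i))) ⟩
        sum (λ i → a l R.* (ι (z i) R.* ι (S l i)))   ≈⟨ *-distribˡ-sum (a l) (λ i → ι (z i) R.* ι (S l i)) ⟨
        a l R.* sum (λ i → ι (z i) R.* ι (S l i))     ≈⟨ R.*-congˡ (ι-∙ z (S l)) ⟨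
        a l R.* ι (z ∙ S l)                           ≈⟨ R.*-congˡ (R.trans (R.reflexive (cong ι (z⊥S l))) ι-0) ⟩
        a l R.* R.0#                                  ≈⟨ R.zeroʳ (a l) ⟩
        R.0#                                          ∎

    divide-relation : ∀ {m} (coeff : Fin m → ℤ) (S : Fin m → ℤ) N k u → u R.* ι N R.≈ R.1# →
      N ℤ.* k ≡ coeff ∙ S → (f : Fin m → R.Carrier) → (∀ l → f l R.≈ (u R.* ι (coeff l)) R.* ι (S l)) →
      ι k R.≈ sum f
    divide-relation {m} coeff S N k u uN≈1 eq f f≈ = begin
      ι k                                           ≈⟨ R.*-identityˡ (ι k) ⟨
      R.1# R.* ι k                                  ≈⟨ R.*-congʳ uN≈1 ⟨
      u R.* ι N R.* ι k                             ≈⟨ R.*-assoc u (ι N) (ι k) ⟩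
      u R.* (ι N R.* ι k)                           ≈⟨ R.*-congˡ (ι-* N k) ⟨
      u R.* ι (N ℤ.* k)                             ≈⟨ R.*-congˡ (R.reflexive (cong ι eq)) ⟩
      u R.* ι (coeff ∙ S)                           ≈⟨ R.*-congˡ (ι-∙ coeff S) ⟩
      u R.* sum (λ l → ι (coeff l) R.* ι (S l))     ≈⟨ *-distribˡ-sum u (λ l → ι (coeff l) R.* ι (S l)) ⟩
      sum (λ l → u R.* (ι (coeff l) R.* ι (S l)))   ≈⟨ sum-cong-≋ {m} (λ l → R.sym (R.*-assoc u (ι (coeff l)) (ι (S l)))) ⟩
      sum (λ l → (u R.* ι (coeff l)) R.* ι (S l))   ≈⟨ sum-cong-≋ {m} f≈ ⟨
      sum f                                         ∎

private
  toℚᵘ-/1 : ∀ z → ℚ.toℚᵘ (z ℚ./ 1) ℚᵘ.≃ mkℚᵘ z 0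
  toℚᵘ-/1 z = ℚₚ.toℚᵘ-fromℚᵘ (mkℚᵘ z 0)

/1-+ : ∀ a b → (a ℤ.+ b) ℚ./ 1 ≡ a ℚ./ 1 ℚ.+ b ℚ./ 1
/1-+ a b = ℚₚ.toℚᵘ-injective (begin
  ℚ.toℚᵘ ((a ℤ.+ b) ℚ./ 1)                        ≈⟨ toℚᵘ-/1 (a ℤ.+ b) ⟩
  mkℚᵘ (a ℤ.+ b) 0                                ≈⟨ *≡* (lemma a b) ⟩
  mkℚᵘ a 0 ℚᵘ.+ mkℚᵘ b 0                          ≈⟨ ℚᵘₚ.+-cong (toℚᵘ-/1 a) (toℚᵘ-/1 b) ⟨
  ℚ.toℚᵘ (a ℚ./ 1) ℚᵘ.+ ℚ.toℚᵘ (b ℚ./ 1)          ≈⟨ ℚₚ.toℚᵘ-homo-+ (a ℚ./ 1) (b ℚ./ 1) ⟨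
  ℚ.toℚᵘ (a ℚ./ 1 ℚ.+ b ℚ./ 1)                    ∎)
  where
  open SetoidReasoning ℚᵘₚ.≃-setoid
  lemma : ∀ a b → (a ℤ.+ b) ℤ.* 1ℤ ≡ (a ℤ.* 1ℤ ℤ.+ b ℤ.* 1ℤ) ℤ.* 1ℤ
  lemma = ℤ-Solver.solve-∀

/1-* : ∀ a b → (a ℤ.* b) ℚ./ 1 ≡ (a ℚ./ 1) ℚ.* (b ℚ./ 1)
/1-* a b = ℚₚ.toℚᵘ-injective (begin
  ℚ.toℚᵘ ((a ℤ.* b) ℚ./ 1)                        ≈⟨ toℚᵘ-/1 (a ℤ.* b) ⟩
  mkℚᵘ a 0 ℚᵘ.* mkℚᵘ b 0                          ≈⟨ ℚᵘₚ.*-cong (toℚᵘ-/1 a) (toℚᵘ-/1 b) ⟨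
  ℚ.toℚᵘ (a ℚ./ 1) ℚᵘ.* ℚ.toℚᵘ (b ℚ./ 1)          ≈⟨ ℚₚ.toℚᵘ-homo-* (a ℚ./ 1) (b ℚ./ 1) ⟨
  ℚ.toℚᵘ ((a ℚ./ 1) ℚ.* (b ℚ./ 1))                    ∎)
  where open SetoidReasoning ℚᵘₚ.≃-setoid

/1-injective : ∀ {z} → z ℚ./ 1 ≡ 0ℚ → z ≡ 0ℤ
/1-injective {z} eq with *≡* z*1≡0 ← ℚᵘₚ.≃-trans (ℚᵘₚ.≃-sym (toℚᵘ-/1 z)) (ℚᵘₚ.≃-reflexive (cong ℚ.toℚᵘ eq)) =
  trans (sym (ℤₚ.*-identityʳ z)) z*1≡0

fromℤ : ℤ → ℝ
fromℤ z = fromℚ (z ℚ./ 1)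

fromℚ-cong : ∀ {p q} → p ≡ q → fromℚ p ≈ fromℚ q
fromℚ-cong {p} refl = CommutativeRing.refl ℝ-commutativeRing {fromℚ p}

fromℤ-+ : ∀ a b → fromℤ (a ℤ.+ b) ≈ (fromℤ a +ᴿ fromℤ b)
fromℤ-+ a b = fromℚ-cong (/1-+ a b)

fromℤ-* : ∀ a b → fromℤ (a ℤ.* b) ≈ (fromℤ a *ᴿ fromℤ b)
fromℤ-* a b = fromℚ-cong (/1-* a b)

-- For a nonzero constant sequence q, the choice ε = |q| contradicts convergence to 0.
fromℤ-0 : ∀ {z} → fromℤ z ≈ fromℚ 0ℚ → z ≡ 0ℤ
fromℤ-0 {z} z≈0 = decidable-stable (z ℤ.≟ 0ℤ) λ z≢0 →
  let q = z ℚ./ 1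
      ∣q∣>0 : 0ℚ ℚ.< ℚ.∣ q ∣
      ∣q∣>0 = ℚₚ.≰⇒> λ ∣q∣≤0 → z≢0 (/1-injective {z} (ℚₚ.∣p∣≡0⇒p≡0 q (ℚₚ.≤-antisym ∣q∣≤0 (ℚₚ.0≤∣p∣ q))))
      N , close = z≈0 ∣q∣>0
  in ℚₚ.<-irrefl (cong ℚ.∣_∣ (ℚₚ.+-identityʳ q)) (close {N} ≤-refl)

reciprocal : ∀ {n} → 0 < n → ∃ λ u → (u *ᴿ fromℕ n) ≈ fromℚ 1ℚ
reciprocal {n} n>0 = fromℚ (ℚ.1/ q) , fromℚ-cong (ℚₚ.*-inverseˡ q)
  where
  q = + n ℚ./ 1
  instance
    q≢0 : ℚ.NonZero q
    q≢0 = ℚ.≢-nonZero λ eq → case (ℤₚ.+-injective (/1-injective {+ n} eq)) n>0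
      where
      case : ∀ {n} → n ≡ 0 → ¬ 0 < n
      case refl ()

open IntegerScalars ℝ-commutativeRing fromℤ (fromℚ-cong {q = 0ℚ} refl) fromℤ-+ fromℤ-* public

≗⇒≈ : ∀ {x y} → (∀ n → seq x n ≡ seq y n) → x ≈ y
≗⇒≈ {x} {y} x≗y 0<ε = 0 , λ {n} _ → subst (ℚ._< _)
  (sym (cong ℚ.∣_∣ (trans (cong (ℚ._- seq y n) (x≗y n)) (ℚₚ.+-inverseʳ (seq y n))))) 0<ε

module _ {i j} {I : Set i} {J : Set j} {B : J → I → ℝ} {x : I → ℝ} (b : J → I → ℕ) (k : I → ℕ)
  (B≡b : ∀ j i → B j i ≡ fromℕ (b j i)) (x≡k : ∀ i → x i ≡ fromℕ (k i)) where

  -- The real coefficients yield only that z ∙ k is 0 as a real number, and then it is 0 as an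
  -- integer. `e` selects finitely many coordinates from I, which may be infinite.
  span-orthogonal : x ∈ span B → ∀ {n} (e : Fin n → I) (z : Fin n → ℤ) →
    (∀ j → z ∙ (λ a → + b j (e a)) ≡ 0ℤ) → z ∙ (λ a → + k (e a)) ≡ 0ℤ
  span-orthogonal (m , a , j , eq) e z z⊥b = fromℤ-0 {z ∙ (λ a → + k (e a))}
    (combination-orthogonal a (λ l a → + b (j l) (e a)) (λ a → + k (e a))
      (λ i l → a l *ᴿ B (j l) (e i))
      (λ i l → ≗⇒≈ {a l *ᴿ B (j l) (e i)} {a l *ᴿ fromℕ (b (j l) (e i))}
        λ n → cong (λ r → seq (a l) n ℚ.* seq r n) (B≡b (j l) (e i)))
      (λ i → subst (_≈ ∑ᴿ (λ l → a l *ᴿ B (j l) (e i))) (x≡k (e i)) (eq (e i)))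
      z (λ l → z⊥b (j l)))

  relation-span : ∀ {scale size} → 0 < scale → (coeff : Fin size → ℤ) (j : Fin size → J) →
    (∀ i → + scale ℤ.* + k i ≡ coeff ∙ (λ l → + b (j l) i)) → x ∈ span B
  relation-span {scale} {size} scale>0 coeff j relation = size , (λ l → proj₁ u *ᴿ fromℤ (coeff l)) , j , λ i →
    subst (_≈ ∑ᴿ (λ l → (proj₁ u *ᴿ fromℤ (coeff l)) *ᴿ B (j l) i)) (sym (x≡k i))
      (divide-relation coeff (λ l → + b (j l) i) (+ scale) (+ k i) (proj₁ u) (proj₂ u) (relation i)
        (λ l → (proj₁ u *ᴿ fromℤ (coeff l)) *ᴿ B (j l) i)
        (λ l → ≗⇒≈
          {(proj₁ u *ᴿ fromℤ (coeff l)) *ᴿ B (j l) i} {(proj₁ u *ᴿ fromℤ (coeff l)) *ᴿ fromℕ (b (j l) i)}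
          λ n → cong (λ r → seq (proj₁ u *ᴿ fromℤ (coeff l)) n ℚ.* seq r n) (B≡b (j l) i)))
    where u = reciprocal {scale} scale>0

-- Closed classes and spans

lower-em : ExcludedMiddle ℓ → ExcludedMiddle 0ℓ
lower-em {ℓ} em {P} = map′ lower lift (em {Lift ℓ P})

lookup-distinct : ∀ {Cs : List Graph} → AllPairs (λ C D → ¬ C ≅ D) Cs →
  ∀ {i j} → lookup Cs i ≅ lookup Cs j → i ≡ j
lookup-distinct (≇ ∷ _) {zero}  {zero}  _  = refl
lookup-distinct {_ ∷ Cs} (≇ ∷ _) {zero}  {suc j} C≅ = contradiction C≅ (All.lookup ≇ (∈-lookup {xs = Cs} j))
lookup-distinct {C ∷ Cs} (≇ ∷ _) {suc i} {zero}  ≅C =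
  contradiction (≅-sym {lookup Cs i} {C} ≅C) (All.lookup ≇ (∈-lookup {xs = Cs} i))
lookup-distinct (_ ∷ ps) {suc i} {suc j} C≅ = cong suc (lookup-distinct ps C≅)

InSpan : Pred Graph ℓ → Graph → Set ℓ
InSpan 𝓕 K = let 𝓒 = ⋃Γ (𝓕 ↓ K ∪ ｛ K ｝) in vec 𝓒 K ∈ span (λ (F : ∃ (𝓕 ↓ K)) → vec 𝓒 (proj₁ F))

-- A list that witnesses finiteness may contain isomorphic graphs and graphs outside 𝓒. Both are
-- removed, as the coordinates have to be distinct types in 𝓒.
IsReduction : Pred Graph ℓ → List Graph → List Graph → Set ℓ
IsReduction 𝓒 Cs Ds =
  All 𝓒 Ds × AllPairs (λ C D → ¬ C ≅ D) Ds × (∀ {C} → C ∈ 𝓒 → Any (C ≅_) Cs → Any (C ≅_) Ds)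

module _ (em : ExcludedMiddle ℓ) where

  module _ (𝓒 : Pred Graph ℓ) (𝓒-≅ : ∀ {C D} → C ≅ D → C ∈ 𝓒 → D ∈ 𝓒) where

    reduction : ∀ Cs → ∃ (IsReduction 𝓒 Cs)
    reduction [] = [] , [] , [] , λ _ ()
    reduction (E ∷ Cs) with reduction Cs
    ... | Ds , Ds⊆𝓒 , distinct , cover with em {E ∈ 𝓒} | Any.any? (E ≅?_) Ds
    ...   | no E∉ | _ = Ds , Ds⊆𝓒 , distinct , λ
      { {C} C∈ (here C≅E) → contradiction (𝓒-≅ {C} {E} C≅E C∈) E∉ ; C∈ (there C≅) → cover C∈ C≅ }
    ...   | yes E∈ | yes E≅ = Ds , Ds⊆𝓒 , distinct , λ
      { {C} C∈ (here C≅E) → Any.map (λ {D} → ≅-trans {C} {E} {D} C≅E) E≅ ; C∈ (there C≅) → cover C∈ C≅ }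
    ...   | yes E∈ | no E≇ = E ∷ Ds , E∈ ∷ Ds⊆𝓒 , ¬Any⇒All¬ Ds E≇ ∷ distinct , λ
      { C∈ (here C≅E) → here C≅E ; C∈ (there C≅) → there (cover C∈ C≅) }

  record Representatives (𝓒 : Pred Graph ℓ) : Set ℓ where
    field
      {size}  : ℕ
      types   : Types size
    open Types types public
    field
      type∈   : ∀ i → type i ∈ 𝓒
      𝓒-types : ∀ {C} → C ∈ 𝓒 → ∃ λ j → type j ≅ C

  opaque
    finite-representatives : ∀ (𝓖 : Pred Graph ℓ) K → EssentiallyFinite (𝓖 ↓ K) →
      Representatives (⋃Γ (𝓖 ↓ K ∪ ｛ K ｝))
    finite-representatives 𝓖 K (Cs , covered) = record
      { types = record
        { type = type
        ; distinct = lookup-distinct (proj₁ (proj₂ (proj₂ reps)))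
        ; connected = λ i → let F , _ , v , C≅ = type∈ i in
            ≅-connected {component F v} {type i} (≅-sym {type i} {component F v} C≅) (component-connected F v)
        }
      ; type∈ = type∈
      ; 𝓒-types = λ {C} C∈ → let C≅ = proj₂ (proj₂ (proj₂ reps)) {C} C∈ (candidate {C} C∈) in
          Any.index C≅ , ≅-sym {C} {type (Any.index C≅)} (lookup-index C≅)
      }
      where
      𝓒 : Pred Graph ℓ
      𝓒 = ⋃Γ (𝓖 ↓ K ∪ ｛ K ｝)

      𝓒-≅ : ∀ {C D} → C ≅ D → C ∈ 𝓒 → D ∈ 𝓒
      𝓒-≅ {C} {D} C≅D (F , F∈ , v , C≅) = F , F∈ , v , ≅-trans {D} {C} {component F v} (≅-sym {C} {D} C≅D) C≅

      -- The given list need not contain the components of K, since K may lie outside 𝓖; they are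
      -- appended.
      candidate : ∀ {C} → C ∈ 𝓒 → Any (C ≅_) (Cs ++ map (component K) (allFin (order K)))
      candidate {C} (F , inj₁ F∈ , C∈) = ++⁺ˡ (covered {C} (F , F∈ , C∈))
      candidate (F , inj₂ refl , v , C≅) = ++⁺ʳ Cs (map⁺ (Any.map (λ { refl → C≅ }) (∈-allFin v)))

      reps : ∃ (IsReduction 𝓒 (Cs ++ map (component K) (allFin (order K))))
      reps = reduction 𝓒 (λ {C} {D} → 𝓒-≅ {C} {D}) (Cs ++ map (component K) (allFin (order K)))

      type : Fin (length (proj₁ reps)) → Graph
      type = lookup (proj₁ reps)

      type∈ : ∀ i → type i ∈ 𝓒
      type∈ i = All.lookup (proj₁ (proj₂ reps)) (∈-lookup {xs = proj₁ reps} i)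

  -- 𝓖 will be either the given class or one of its sections.
  module FiniteTypes (𝓖 : Pred Graph ℓ) (K : Graph) (reps : Representatives (⋃Γ (𝓖 ↓ K ∪ ｛ K ｝))) where
    open Representatives reps

    𝓒-covers : ∀ F → F ∈ (𝓖 ↓ K ∪ ｛ K ｝) → Covers F
    𝓒-covers F F∈ v = 𝓒-types {component F v} (F , F∈ , v , ≅-refl {component F v})

    μ : Graph → Fin size → ℕ
    μ F i = multiplicity F (type i)

    private
      em₀ : ExcludedMiddle 0ℓ
      em₀ = lower-em em

      homsᵀ : Graph → Fin size → ℕ
      homsᵀ = homs em₀ types

    hom-monomial : ∀ F → F ∈ (𝓖 ↓ K ∪ ｛ K ｝) → ∀ G → hom F G ≡ monomial (homsᵀ G) (μ F)
    hom-monomial F F∈ G = trans (hom-types F (𝓒-covers F F∈) G)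
      (monomial-cong {m = μ F} (λ j → sym (homs≡hom em₀ types G j)) (λ _ → refl))

    rows : ∃ (𝓖 ↓ K) → Fin size → ℤ
    rows (F , _) = +_ ∘ μ F

    target : Fin size → ℤ
    target = +_ ∘ μ K

    K∈ : K ∈ (𝓖 ↓ K ∪ ｛ K ｝)
    K∈ = inj₂ refl

    Related : Set ℓ
    Related = IntegerRelation rows target

    -- Every type occurring in K occurs in a row of the relation. Besides settling vanishing counts,
    -- this shows that the members of the closure of a section map to the graph that defines the
    -- section.
    relation⇒→ₕ : Related → ∀ X → (∀ F → F ∈ 𝓖 ↓ K → 0 < hom F X) → 0 < hom K X
    relation⇒→ₕ rel X pos = subst (0 <_) (sym (hom-monomial K K∈ X))
      (relation-pos {S = μ ∘ proj₁} rel (homsᵀ X) λ a → let F , F∈ = IntegerRelation.index rel a in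
        subst (0 <_) (hom-monomial F (inj₁ F∈) X) (pos F F∈))

    relation⇒cl : Simple K → Related → K ∈ cl 𝓖
    relation⇒cl simple rel = simple , λ G H _ _ G≡H → by G H G≡H (hom K G ℕ.≟ 0) (hom K H ℕ.≟ 0)
      where
      transfer : ∀ G H → G ≡[ 𝓖 ] H → hom K G ≢ 0 → ∀ F → F ∈ 𝓖 ↓ K → 0 < hom F H
      transfer G H G≡H K→G F (F∈ , F→K) = subst (0 <_) (G≡H F F∈)
        (→ₕ-pos {F} {G} (→ₕ-trans {F} {K} {G} (pos-→ₕ {F} {K} F→K) (pos-→ₕ {K} {G} (n≢0⇒n>0 K→G))))
      by : ∀ G H → G ≡[ 𝓖 ] H → Dec (hom K G ≡ 0) → Dec (hom K H ≡ 0) → hom K G ≡ hom K H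
      by G H G≡H (yes G≡0) (yes H≡0) = trans G≡0 (sym H≡0)
      by G H G≡H (no G≢0) (yes H≡0) =
        contradiction (sym H≡0) (<⇒≢ (relation⇒→ₕ rel H (transfer G H G≡H G≢0)))
      by G H G≡H (yes G≡0) (no H≢0) =
        contradiction (sym G≡0) (<⇒≢ (relation⇒→ₕ rel G (transfer H G (λ F F∈ → sym (G≡H F F∈)) H≢0)))
      by G H G≡H (no G≢0) (no H≢0) = trans (hom-monomial K K∈ G) (trans
        (relation-equal {S = μ ∘ proj₁} rel (homsᵀ G) (homsᵀ H)
          (λ a → let F , F∈ = IntegerRelation.index rel a in
            trans (sym (hom-monomial F (inj₁ F∈) G)) (trans (G≡H F (proj₁ F∈)) (hom-monomial F (inj₁ F∈) H)))
          (λ a → let F , F∈ = IntegerRelation.index rel a in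
            subst (0 <_) (hom-monomial F (inj₁ F∈) H) (transfer G H G≡H G≢0 F F∈)))
        (sym (hom-monomial K K∈ H)))

    -- Multiplying both graphs by K makes them agree on all F without homomorphisms to K.
    separator⇒∉cl : (sep : Separator rows target) → ∀ t →
      Realisation em₀ types (suc t) (_⁺ ∘ Separator.z sep) (_⁻ ∘ Separator.z sep) → K ∉ cl 𝓖
    separator⇒∉cl sep t realisation (simple , closed) = contradiction K-equal separated
      where
      open Separator sep
      p q : Fin size → ℕ
      p = _⁺ ∘ z
      q = _⁻ ∘ z
      open Realisation realisation

      ratio′ : ∀ F → F ∈ (𝓖 ↓ K ∪ ｛ K ｝) →
        hom F G * (suc t ^ (p ∙ℕ μ F) * suc (suc t) ^ (q ∙ℕ μ F))
          ≡ hom F H * (suc (suc t) ^ (p ∙ℕ μ F) * suc t ^ (q ∙ℕ μ F))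
      ratio′ F F∈ = subst₂
        (λ a b → a * (suc t ^ (p ∙ℕ μ F) * suc (suc t) ^ (q ∙ℕ μ F))
          ≡ b * (suc (suc t) ^ (p ∙ℕ μ F) * suc t ^ (q ∙ℕ μ F)))
        (sym (hom-monomial F F∈ G)) (sym (hom-monomial F F∈ H))
        (monomial-ratio {x = homsᵀ G} {y = homsᵀ H} {s = suc (suc t)} {t = suc t} p q ratio (μ F))

      -- Orthogonality makes the two exponents equal, so the ratio of hom(F, G) to hom(F, H) is 1.
      equal : ∀ F → F ∈ 𝓖 ↓ K → hom F G ≡ hom F H
      equal F F∈ = ratio-equal {hom F G} {hom F H} t {p ∙ℕ μ F} {q ∙ℕ μ F}
        (ℤₚ.+-injective (ℤₚ.i-j≡0⇒i≡j (+ (p ∙ℕ μ F)) (+ (q ∙ℕ μ F))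
          (trans (sym (∙-parts z (μ F))) (orthogonal (F , F∈)))))
        (ratio′ F (inj₁ F∈))

      G×K≡H×K : (G ×ᴳ K) ≡[ 𝓖 ] (H ×ᴳ K)
      G×K≡H×K F F∈ = trans (hom-× F G K) (trans (by (hom F K ℕ.≟ 0)) (sym (hom-× F H K)))
        where
        by : Dec (hom F K ≡ 0) → hom F G * hom F K ≡ hom F H * hom F K
        by (yes F↛K) = trans (cong (hom F G *_) F↛K)
          (trans (*-zeroʳ (hom F G)) (sym (trans (cong (hom F H *_) F↛K) (*-zeroʳ (hom F H)))))
        by (no F→K) = cong (_* hom F K) (equal F (F∈ , n≢0⇒n>0 F→K))

      -- The identity makes hom(K, K) positive, so the common factor cancels.
      K-equal : hom K G ≡ hom K H
      K-equal = *-cancelʳ-≡ (hom K G) (hom K H) (hom K K) {{>-nonZero (→ₕ-pos {K} {K} (→ₕ-id K))}}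
        (trans (sym (hom-× K G K)) (trans
          (closed (G ×ᴳ K) (H ×ᴳ K) (×ᴳ-simple G {K} simple) (×ᴳ-simple H {K} simple) G×K≡H×K)
          (hom-× K H K)))

      -- Equal positive counts make the ratio 1, hence the exponents equal and z ∙ target zero.
      separated : hom K G ≢ hom K H
      separated eq = separates (trans (∙-parts z (μ K)) (ℤₚ.i≡j⇒i-j≡0 (cong +_
        (ratio-differs {hom K H} t {p ∙ℕ μ K} {q ∙ℕ μ K}
        (subst (0 <_) (trans (sym (hom-monomial K K∈ G)) eq)
          (∏-pos (λ i → homsᵀ G i ^ μ K i) λ i → ^-pos (μ K i) (G-pos i)))
        (trans (cong (_* (suc t ^ (p ∙ℕ μ K) * suc (suc t) ^ (q ∙ℕ μ K))) (sym eq)) (ratio′ K K∈))))))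

    private
      entries : ∃ (𝓖 ↓ K) → ∃ (⋃Γ (𝓖 ↓ K ∪ ｛ K ｝)) → ℕ
      entries (F , _) (C , _) = multiplicity F C

    span⇒no-separator : InSpan 𝓖 K → ¬ Separator rows target
    span⇒no-separator K∈span sep = separates (span-orthogonal
      {B = λ F → vec (⋃Γ (𝓖 ↓ K ∪ ｛ K ｝)) (proj₁ F)} {x = vec (⋃Γ (𝓖 ↓ K ∪ ｛ K ｝)) K}
      entries (multiplicity K ∘ proj₁) (λ _ _ → refl) (λ _ → refl) K∈span
      (λ i → type i , type∈ i) z orthogonal)
      where open Separator sep

    -- The relation is given at the representatives; multiplicities are invariant under isomorphism,
    -- so it extends to every coordinate in ⋃Γ.
    relation⇒span : Related → InSpan 𝓖 K
    relation⇒span rel = relation-span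
      {B = λ F → vec (⋃Γ (𝓖 ↓ K ∪ ｛ K ｝)) (proj₁ F)} {x = vec (⋃Γ (𝓖 ↓ K ∪ ｛ K ｝)) K}
      entries (multiplicity K ∘ proj₁) (λ _ _ → refl) (λ _ → refl) scale-pos coeff index′
      λ (C , C∈) → relation-at {C} C∈
      where
      open IntegerRelation rel renaming (index to index′; size to terms)
      relation-at : ∀ {C} → C ∈ ⋃Γ (𝓖 ↓ K ∪ ｛ K ｝) →
        + scale ℤ.* + multiplicity K C ≡ coeff ∙ (λ l → + multiplicity (proj₁ (index′ l)) C)
      relation-at {C} C∈ = trans (cong (λ m → + scale ℤ.* + m) (sym (same K))) (trans (relation i)
        (∑ℤ-cong {terms} λ l → cong (λ m → coeff l ℤ.* + m) (same (proj₁ (index′ l)))))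
        where
        i = proj₁ (𝓒-types {C} C∈)
        same : ∀ F → μ F i ≡ multiplicity F C
        same F = multiplicity-≅ F {type i} {C} (proj₂ (𝓒-types {C} C∈))

    private
      by-separation : ¬ Separator rows target → Related
      by-separation no-sep = [ id , (λ sep → contradiction sep no-sep) ]′ (relation-or-separator em rows target)

    -- Descent from real to integer coefficients: without a relation there is an integer separator,
    -- which excludes real combinations too.
    span⇒relation : InSpan 𝓖 K → Related
    span⇒relation K∈span = by-separation (span⇒no-separator K∈span)

    cl⇒relation : K ∈ cl 𝓖 → Related
    cl⇒relation K∈cl = by-separation λ sep →
      separator⇒∉cl sep (proj₁ (realise em₀ types)) (proj₂ (realise em₀ types) _ _) K∈cl

-- Loops, simplicity and the equivalences

simple? : Decidable Simple
simple? G = all? λ v → adj G v v ≟ᵇ false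

⊆cl : ∀ {𝓕 : Pred Graph ℓ} → 𝓕 ⊆ Simple → 𝓕 ⊆ cl 𝓕
⊆cl 𝓕-simple F∈ = 𝓕-simple F∈ , λ _ _ _ _ G≡H → G≡H _ F∈

cl-mono : ∀ {𝓕 𝓖 : Pred Graph ℓ} → 𝓕 ⊆ 𝓖 → cl 𝓕 ⊆ cl 𝓖
cl-mono 𝓕⊆𝓖 (simple , closed) = simple , λ G H sG sH G≡H → closed G H sG sH λ F F∈ → G≡H F (𝓕⊆𝓖 F∈)

looped : ∀ G → ¬ Simple G → ∃ λ v → T (adj G v v)
looped G ¬simple with v , v≁v ← ¬∀⟶∃¬ (order G) (λ v → adj G v v ≡ false) (λ v → adj G v v ≟ᵇ false) ¬simple
  = v , true-at v≁v
  where
  true-at : ∀ {b} → b ≢ false → T b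
  true-at {true}  _  = tt
  true-at {false} ≢ = contradiction refl ≢

looped-hom : ∀ {K} → ¬ Simple K → ∀ F → 0 < hom F K
looped-hom {K} ¬simple F = let v , v~v = looped K ¬simple in →ₕ-pos {F} {K} ((λ _ → v) , λ _ _ _ → v~v)

→ₕ-simple : ∀ {F G} → F →ₕ G → Simple G → Simple F
→ₕ-simple {F} {G} (f , f-hom) simple v with adj F v v in eq
... | false = refl
... | true  = contradiction (subst T (simple (f v)) (f-hom v v (subst T (sym eq) tt))) λ ()

component-→ₕ : ∀ G v → component G v →ₕ G
component-→ₕ G v = lookup (members (reachable? G v)) , λ _ _ → id

-- The component of a loop does not occur in simple graphs.
span⇒simple : ∀ {𝓕 : Pred Graph ℓ} → 𝓕 ⊆ Simple → ∀ K → InSpan 𝓕 K → Simple K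
span⇒simple {𝓕 = 𝓕} 𝓕-simple K K∈span = decidable-stable (simple? K) λ ¬simple →
  let 𝓒 = ⋃Γ (𝓕 ↓ K ∪ ｛ K ｝)
      v , v~v = looped K ¬simple
      C = component K v
      i , i≡v = memberIndex (reachable? K v) {v} nil
      C-looped : T (adj C i i)
      C-looped = subst₂ (λ x y → T (adj K x y)) (sym i≡v) (sym i≡v) v~v
      absent : ∀ F → F ∈ 𝓕 → multiplicity F C ≡ 0
      absent F F∈ = decidable-stable (multiplicity F C ℕ.≟ 0) λ ≢0 →
        let w , C≅ = multiplicity-Γ F {C} (n≢0⇒n>0 ≢0)
            C→F = →ₕ-trans {C} {component F w} {F} (≅-→ₕ {C} {component F w} C≅) (component-→ₕ F w)
        in subst T (→ₕ-simple {C} {F} C→F (𝓕-simple F∈) i) C-looped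
      -- With C as the only coordinate and 1 as the test vector, orthogonality says that a
      -- multiplicity is 0.
      1∙ : ∀ m → (λ (_ : Fin 1) → 1ℤ) ∙ (λ _ → + m) ≡ + m
      1∙ m = trans (ℤₚ.+-identityʳ (1ℤ ℤ.* + m)) (ℤₚ.*-identityˡ (+ m))
      vanish : (λ (_ : Fin 1) → 1ℤ) ∙ (λ _ → + multiplicity K C) ≡ 0ℤ
      vanish = span-orthogonal {B = λ F → vec 𝓒 (proj₁ F)} {x = vec 𝓒 K}
        (λ (F , _) (C , _) → multiplicity F C) (multiplicity K ∘ proj₁) (λ _ _ → refl) (λ _ → refl) K∈span
        {1} (λ _ → C , K , inj₂ refl , v , ≅-refl {C})
        (λ _ → 1ℤ) (λ (F , F∈ , _) → trans (1∙ (multiplicity F C)) (cong +_ (absent F F∈)))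
  in <⇒≢ (multiplicity-component K v) (sym (ℤₚ.+-injective (trans (sym (1∙ (multiplicity K C))) vanish)))

theorem27 : ∀ {ℓ} → ExcludedMiddle ℓ → (𝓕 : Pred Graph ℓ) → 𝓕 ⊆ Simple → EssentiallyProfinite 𝓕 →
    (HomDistinguishingClosed 𝓕 ⇔ (∀ K → let 𝓒 = ⋃Γ (𝓕 ↓ K ∪ ｛ K ｝) in vec 𝓒 K ∈ span (λ (F : ∃ (𝓕 ↓ K)) → vec 𝓒 (proj₁ F)) → K ∈ 𝓕))
    × (HomDistinguishingClosed 𝓕 ⇔ (∀ K → HomDistinguishingClosed (𝓕 ↓ K)))
theorem27 em 𝓕 𝓕-simple profinite = mk⇔ closed⇒span span⇒closed , mk⇔ closed⇒sections sections⇒closed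
  where
  closed⇒span : HomDistinguishingClosed 𝓕 → ∀ K → InSpan 𝓕 K → K ∈ 𝓕
  closed⇒span (cl⊆𝓕 , _) K K∈span = cl⊆𝓕 (relation⇒cl simple (span⇒relation K∈span))
    where
    -- Simplicity is established before finiteness, which `profinite` grants for simple K only.
    simple : Simple K
    simple = span⇒simple {𝓕 = 𝓕} 𝓕-simple K K∈span
    open FiniteTypes em 𝓕 K (finite-representatives em 𝓕 K (profinite K simple))

  span⇒closed : (∀ K → InSpan 𝓕 K → K ∈ 𝓕) → HomDistinguishingClosed 𝓕
  span⇒closed span⊆𝓕 = (λ {K} → cl⊆𝓕 K) , ⊆cl 𝓕-simple
    where
    cl⊆𝓕 : ∀ K → K ∈ cl 𝓕 → K ∈ 𝓕
    cl⊆𝓕 K K∈cl = span⊆𝓕 K (relation⇒span (cl⇒relation K∈cl))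
      where open FiniteTypes em 𝓕 K (finite-representatives em 𝓕 K (profinite K (proj₁ K∈cl)))

  closed⇒sections : HomDistinguishingClosed 𝓕 → ∀ K → HomDistinguishingClosed (𝓕 ↓ K)
  closed⇒sections (cl⊆𝓕 , _) K =
      (λ {L} L∈cl → cl⊆𝓕 (cl-mono {𝓕 = 𝓕 ↓ K} {𝓖 = 𝓕} proj₁ {L} L∈cl) , L→K L L∈cl (simple? K))
    , ⊆cl (𝓕-simple ∘ proj₁)
    where
    -- Membership in 𝓕 comes from monotonicity of the closure; a homomorphism to K remains to be
    -- found. A looped K receives every graph, and for simple K the relation for L involves only
    -- graphs that map to K.
    L→K : ∀ L → L ∈ cl (𝓕 ↓ K) → Dec (Simple K) → 0 < hom L K
    L→K L L∈cl (no ¬simple)  = looped-hom {K} ¬simple L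
    L→K L L∈cl (yes simple) = relation⇒→ₕ (cl⇒relation L∈cl) K λ F F∈ → proj₂ (proj₁ F∈)
      where
      -- Finiteness is inherited from the section at K, of which the graphs that also map to L form
      -- a subclass.
      finite : EssentiallyFinite ((𝓕 ↓ K) ↓ L)
      finite = let Cs , cover = profinite K simple in
        Cs , λ {C} (F , (F∈ , _) , C∈) → cover {C} (F , F∈ , C∈)
      open FiniteTypes em (𝓕 ↓ K) L (finite-representatives em (𝓕 ↓ K) L finite)

  -- Every graph maps to the loop, so 𝓕 ↓ loop is 𝓕.
  sections⇒closed : (∀ K → HomDistinguishingClosed (𝓕 ↓ K)) → HomDistinguishingClosed 𝓕
  sections⇒closed sections =
      (λ {K} K∈cl → proj₁ (proj₁ (sections loop) (cl-mono {𝓕 = 𝓕} {𝓖 = 𝓕 ↓ loop}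
        (λ {F} F∈ → F∈ , subst (0 <_) (sym (hom-loop F)) (s≤s z≤n)) {K} K∈cl)))
    , ⊆cl 𝓕-simple
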